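{- For every $\varepsilon > 0$ there exist $C = C(\varepsilon) > 0$ and $k_0 = k_0(\varepsilon) > 0$ such that the following holds. Let $k$ and $\ell$ be integers satisfying $k \ge k_0$ and $Ck \le \ell \le \binom{k}{2} - Ck$. Then $$\mathrm{ind}(k,\ell) \le \frac{1}{2} + \varepsilon.$$
   Context: All graphs are finite and simple. For a positive integer $k$ and a graph $G$ with at least $k$ vertices, let $A = A_{G,k}$ be chosen uniformly at random from all $k$-element subsets of $V(G)$, and let $X_{G,k} = e(G[A])$ be the number of edges of $G$ with both endpoints in $A$. For integers $n \ge k$ and $0 \le \ell \le \binom{k}{2}$ let $I(n,k,\ell) = \max\{\mathbb{P}(X_{G,k} = \ell) : G \text{ is a graph on } n \text{ vertices}\}$. For fixed $k,\ell$ the sequence $I(n,k,\ell)$ is non-increasing in $n$, and the edge-inducibility is defined by $\mathrm{ind}(k,\ell) := \lim_{n\to\infty} I(n,k,\ell)$. -}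

module Defs where

import Algebra.Properties.CommutativeSemigroup as CommutativeSemigroupProperties
open import Algebra.Bundles using (CommutativeMonoid)
open import Data.Bool using (Bool; true; false)
import Data.Bool.Properties as Bool
open import Data.Fin using (Fin; _<_)
open import Data.Fin.Properties using (all?; _<?_)
open import Data.Fin.Subset using (Subset; inside; outside; ∣_∣) renaming (_∈_ to _∈ₛ_)
open import Data.Fin.Subset.Properties using () renaming (_∈?_ to _∈ₛ?_)
open import Data.Integer using (+_)
import Data.List.Extrema as Extrema
open import Data.List using (List; []; _∷_; length; map; filter; allFin; cartesianProduct; cartesianProductWith)
open import Data.List.Membership.Propositional using (_∈_)
open import Data.List.Membership.Propositional.Properties
  using (∈-cartesianProductWith⁺; ∈-filter⁺; ∈-filter⁻; ∈-map⁺; ∈-map⁻)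
import Data.List.Relation.Unary.All as All
open import Data.List.Relation.Unary.Any using (here; there)
open import Data.Nat as ℕ using (ℕ; zero; suc)
import Data.Nat.Properties as ℕ
open import Data.Product using (Σ-syntax; ∃-syntax; _×_; _,_; proj₁; proj₂)
open import Data.Rational as ℚ using (ℚ; 0ℚ; ½)
import Data.Rational.Properties as ℚ
open import Data.Sum using (inj₁; inj₂)
open import Data.Vec as Vec using (Vec; []; _∷_; lookup)
open import Data.Vec.Properties using (lookup-replicate)
open import Level using (0ℓ)
open import Relation.Binary.Bundles using (DecTotalOrder)
open import Relation.Binary.PropositionalEquality using (_≡_; refl; sym; subst; cong; trans)
open import Relation.Nullary.Decidable using (_×-dec_)
open import Relation.Unary using (Pred; Decidable)

-- Real numbers: Cauchy sequences of rationals, compared up to the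
-- order-induced equality (x ≈ y iff x ≤ y and y ≤ x).

IsCauchy : (ℕ → ℚ) → Set
IsCauchy x = ∀ δ → 0ℚ ℚ.< δ →
  ∃[ N ] (∀ m n → N ℕ.≤ m → N ℕ.≤ n → ℚ.∣ x m ℚ.- x n ∣ ℚ.≤ δ)

record ℝ : Set where
  constructor mkℝ
  field
    seq    : ℕ → ℚ
    cauchy : IsCauchy seq

open ℝ public

fromℚ : ℚ → ℝ
fromℚ q = mkℝ (λ _ → q) λ δ 0<δ → 0 , λ _ _ _ _ →
  subst (ℚ._≤ δ) (sym (cong ℚ.∣_∣ (ℚ.+-inverseʳ q))) (ℚ.<⇒≤ 0<δ)

infix  4 _≤ℝ_ _<ℝ_
infixl 6 _+ℝ_

_≤ℝ_ : ℝ → ℝ → Set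
x ≤ℝ y = ∀ δ → 0ℚ ℚ.< δ → ∃[ N ] (∀ n → N ℕ.≤ n → seq x n ℚ.≤ seq y n ℚ.+ δ)

_<ℝ_ : ℝ → ℝ → Set
x <ℝ y = Σ[ δ ∈ ℚ ] (0ℚ ℚ.< δ) × ∃[ N ] (∀ n → N ℕ.≤ n → seq x n ℚ.+ δ ℚ.≤ seq y n)

_+ℝ_ : ℝ → ℝ → ℝ
seq (x +ℝ y) n = seq x n ℚ.+ seq y n
cauchy (x +ℝ y) δ 0<δ = N₁ ℕ.⊔ N₂ , λ m n N≤m N≤n → begin
  ℚ.∣ (seq x m ℚ.+ seq y m) ℚ.- (seq x n ℚ.+ seq y n) ∣
    ≡⟨ cong ℚ.∣_∣ (rearrange (seq x m) (seq y m) (seq x n) (seq y n)) ⟩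
  ℚ.∣ (seq x m ℚ.- seq x n) ℚ.+ (seq y m ℚ.- seq y n) ∣
    ≤⟨ ℚ.∣p+q∣≤∣p∣+∣q∣ (seq x m ℚ.- seq x n) (seq y m ℚ.- seq y n) ⟩
  ℚ.∣ seq x m ℚ.- seq x n ∣ ℚ.+ ℚ.∣ seq y m ℚ.- seq y n ∣
    ≤⟨ ℚ.+-mono-≤
         (proj₂ cx m n (ℕ.≤-trans (ℕ.m≤m⊔n N₁ N₂) N≤m) (ℕ.≤-trans (ℕ.m≤m⊔n N₁ N₂) N≤n))
         (proj₂ cy m n (ℕ.≤-trans (ℕ.m≤n⊔m N₁ N₂) N≤m) (ℕ.≤-trans (ℕ.m≤n⊔m N₁ N₂) N≤n)) ⟩
  ½ ℚ.* δ ℚ.+ ½ ℚ.* δ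
    ≡⟨ sym (ℚ.*-distribʳ-+ δ ½ ½) ⟩
  (½ ℚ.+ ½) ℚ.* δ
    ≡⟨ ℚ.*-identityˡ δ ⟩
  δ ∎
  where
  open ℚ.≤-Reasoning
  open CommutativeSemigroupProperties
    (CommutativeMonoid.commutativeSemigroup ℚ.+-0-commutativeMonoid) using (interchange)
  rearrange : ∀ a b c d → (a ℚ.+ b) ℚ.- (c ℚ.+ d) ≡ (a ℚ.- c) ℚ.+ (b ℚ.- d)
  rearrange a b c d = trans (cong (a ℚ.+ b ℚ.+_) (ℚ.neg-distrib-+ c d))
    (interchange a b (ℚ.- c) (ℚ.- d))
  0<δ/2 : 0ℚ ℚ.< ½ ℚ.* δ
  0<δ/2 = ℚ.*-monoʳ-<-pos ½ 0<δ
  cx = cauchy x (½ ℚ.* δ) 0<δ/2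
  cy = cauchy y (½ ℚ.* δ) 0<δ/2
  N₁ = proj₁ cx
  N₂ = proj₁ cy

-- |a n - L| ≤ δ, written out as two inequalities between reals.
infix 4 _ConvergesTo_

_ConvergesTo_ : (ℕ → ℚ) → ℝ → Set
a ConvergesTo L = ∀ δ → 0ℚ ℚ.< δ → ∃[ N ] (∀ n → N ℕ.≤ n →
  (fromℚ (a n) ≤ℝ L +ℝ fromℚ δ) × (L ≤ℝ fromℚ (a n) +ℝ fromℚ δ))

-- Uniform probability on the entries of a nonempty list.  The value 0 on
-- the empty list is a convention.

ℙ : ∀ {A : Set} {P : Pred A 0ℓ} → List A → Decidable P → ℚ
ℙ []          P? = 0ℚ
ℙ Ω@(_ ∷ ωs) P? = + length (filter P? Ω) ℚ./ suc (length ωs)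

vectors : ∀ {A : Set} → List A → (n : ℕ) → List (Vec A n)
vectors xs zero    = [] ∷ []
vectors xs (suc n) = cartesianProductWith _∷_ xs (vectors xs n)

-- The k-element subsets of Fin n, each listed once.
kSubsets : (n k : ℕ) → List (Subset n)
kSubsets n k = filter (λ A → ∣ A ∣ ℕ.≟ k) (vectors (outside ∷ inside ∷ []) n)

-- Graphs on the vertex set Fin n, given by their adjacency matrices.

Matrix : ℕ → Set
Matrix n = Vec (Vec Bool n) n

entry : ∀ {n} → Matrix n → Fin n → Fin n → Bool
entry M i j = lookup (lookup M i) j

IsSimpleGraph : ∀ {n} → Matrix n → Set
IsSimpleGraph M =
  (∀ i j → entry M i j ≡ entry M j i) × (∀ i → entry M i i ≡ false)

isSimpleGraph? : ∀ {n} → Decidable (IsSimpleGraph {n})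
isSimpleGraph? M =
  all? (λ i → all? λ j → entry M i j Bool.≟ entry M j i) ×-dec
  all? (λ i → entry M i i Bool.≟ false)

matrices : (n : ℕ) → List (Matrix n)
matrices n = vectors (vectors (false ∷ true ∷ []) n) n

graphs : (n : ℕ) → List (Matrix n)
graphs n = filter isSimpleGraph? (matrices n)

-- Each edge {i , j} is counted once, as the pair (i , j) with i < j.
IsEdgeWithin : ∀ {n} → Matrix n → Subset n → Fin n × Fin n → Set
IsEdgeWithin G A (i , j) = (i < j) × (i ∈ₛ A) × (j ∈ₛ A) × (entry G i j ≡ true)

isEdgeWithin? : ∀ {n} (G : Matrix n) (A : Subset n) → Decidable (IsEdgeWithin G A)
isEdgeWithin? G A (i , j) =
  (i <? j) ×-dec (i ∈ₛ? A) ×-dec (j ∈ₛ? A) ×-dec (entry G i j Bool.≟ true)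

edgeCount : ∀ {n} → Matrix n → Subset n → ℕ
edgeCount {n} G A = length (filter (isEdgeWithin? G A) (cartesianProduct (allFin n) (allFin n)))

ℙ[X≡_] : ∀ {n} → ℕ → Matrix n → ℕ → ℚ
ℙ[X≡_] {n} ℓ G k = ℙ (kSubsets n k) (λ A → edgeCount G A ℕ.≟ ℓ)

open Extrema (DecTotalOrder.totalOrder ℚ.≤-decTotalOrder) using (max; xs≤max; argmax-sel)

-- The default 0 is harmless, as probabilities are nonnegative.  For n < k
-- there are no k-subsets and the value is 0, which does not affect limits.
I : (n k ℓ : ℕ) → ℚ
I n k ℓ = max 0ℚ (map (λ G → ℙ[X≡ ℓ ] G k) (graphs n))

∈-vectors : ∀ {A : Set} {xs : List A} → (∀ a → a ∈ xs) → ∀ {n} (v : Vec A n) → v ∈ vectors xs n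
∈-vectors all-in []      = here refl
∈-vectors all-in (a ∷ v) = ∈-cartesianProductWith⁺ _∷_ (all-in a) (∈-vectors all-in v)

∈-graphs : ∀ {n} (G : Matrix n) → IsSimpleGraph G → G ∈ graphs n
∈-graphs G simple = ∈-filter⁺ isSimpleGraph? (∈-vectors (∈-vectors bool) G) simple
  where
  bool : ∀ b → b ∈ (false ∷ true ∷ [])
  bool false = here refl
  bool true  = there (here refl)

emptyGraph : ∀ n → Matrix n
emptyGraph n = Vec.replicate n (Vec.replicate n false)

emptyGraph-simple : ∀ n → IsSimpleGraph (emptyGraph n)
emptyGraph-simple n = (λ i j → trans (no-edge i j) (sym (no-edge j i))) , λ i → no-edge i i
  where
  no-edge : ∀ i j → entry (emptyGraph n) i j ≡ false
  no-edge i j = trans (cong (λ r → lookup r j) (lookup-replicate i (Vec.replicate n false)))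
                      (lookup-replicate j false)

0≤ℙ : ∀ {A : Set} {P : Pred A 0ℓ} (Ω : List A) (P? : Decidable P) → 0ℚ ℚ.≤ ℙ Ω P?
0≤ℙ []          P? = ℚ.≤-refl
0≤ℙ Ω@(_ ∷ ωs) P? = ℚ.nonNegative⁻¹ _ ⦃ ℚ.normalize-nonNeg (length (filter P? Ω)) (suc (length ωs)) ⦄

-- I n k ℓ is the maximum over all simple graphs on Fin n.
I-upper : ∀ {n} k ℓ (G : Matrix n) → IsSimpleGraph G → ℙ[X≡ ℓ ] G k ℚ.≤ I n k ℓ
I-upper {n} k ℓ G simple =
  All.lookup (xs≤max 0ℚ (map p (graphs n))) (∈-map⁺ p (∈-graphs G simple))
  where p = λ H → ℙ[X≡ ℓ ] H k

I-attained : ∀ n k ℓ → Σ[ G ∈ Matrix n ] IsSimpleGraph G × I n k ℓ ≡ ℙ[X≡ ℓ ] G k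
I-attained n k ℓ with argmax-sel (λ q → q) 0ℚ (map (λ H → ℙ[X≡ ℓ ] H k) (graphs n))
... | inj₁ I≡0 = emptyGraph n , emptyGraph-simple n , ℚ.≤-antisym
      (subst (ℚ._≤ ℙ[X≡ ℓ ] (emptyGraph n) k) (sym I≡0)
        (0≤ℙ (kSubsets n k) (λ A → edgeCount (emptyGraph n) A ℕ.≟ ℓ)))
      (I-upper k ℓ (emptyGraph n) (emptyGraph-simple n))
... | inj₂ I∈ with ∈-map⁻ (λ H → ℙ[X≡ ℓ ] H k) I∈
...   | G , G∈ , eq = G , proj₂ (∈-filter⁻ isSimpleGraph? {xs = matrices n} G∈) , eq

-- "ind(k,ℓ) = L".  Limits are unique up to equality of reals.
IsEdgeInducibility : (k ℓ : ℕ) → ℝ → Set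
IsEdgeInducibility k ℓ L = (λ n → I n k ℓ) ConvergesTo L

{-# OPTIONS --safe #-}

-- Let e(f) be the number of edges spanned by the letters of a random word f of length k over the
-- vertices.  Call x and y twins if their neighbourhoods differ in O(n / k) vertices.  If x, y are
-- not twins, then e(q x) = e(q y) forces x and y to have equally many neighbours in the random
-- word q, which is unlikely by anti-concentration.  Hence, if k times the density of non-twin
-- pairs is large, choose some letters of f by first drawing a pair of candidates for each: almost
-- surely some pair is not a pair of twins, and at most one of its two candidates can give e(f) = ℓ,
-- so the probability is at most 1/2 + o(1).  If instead almost all pairs are twins, then the graph
-- has few paths of an edge followed by a non-edge.  Since (#edges)(#non-edges) in f is bounded by
-- k times the number of such mixed paths in f, Markov's inequality makes it unlikely that f has at
-- least Ck edges and at least Ck non-edges.  Random words and random k-subsets agree as n → ∞.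

module Submission where

open import Defs
open import Data.Nat as ℕ using (ℕ; zero; suc; _+_; _^_; _∸_; _!; z≤n; s≤s) renaming (_*_ to _·_; _≤_ to _≼_)
open import Data.Nat.Combinatorics using (_C_; nC1≡n; nCk+nC[k+1]≡[n+1]C[k+1])
open import Data.Product using (Σ-syntax; ∃-syntax; _×_; _,_; proj₁; proj₂)
open import Data.Rational as ℚ using (ℚ; 0ℚ; ½; _/_; _*_; _-_)

import Algebra.Properties.Semiring.Sum as Sum
open import Data.Bool as Bool using (Bool; true; false; not; _∧_)
open import Data.Empty using (⊥; ⊥-elim)
open import Data.Fin as Fin using (Fin; zero; suc; toℕ; fromℕ<)
import Data.Fin.Properties as Fin
open import Data.Fin.Subset using (Subset; inside; outside) renaming (∣_∣ to card)
open import Data.Fin.Subset.Properties using () renaming (_∈?_ to _∈ₛ?_)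
import Data.Integer.Properties as ℤ
open import Data.List as List using (List; []; _∷_; _++_; length)
open import Data.Nat.Properties as ℕₚ using (module ≤-Reasoning)
open import Data.Nat.Tactic.RingSolver using (solve-∀)
import Data.Rational.Properties as ℚ
open import Data.Rational.Unnormalised as ℚᵘ using (mkℚᵘ)
import Data.Rational.Unnormalised.Properties as ℚᵘ
open import Data.Sum using (inj₁; inj₂)
open import Data.Vec as Vec using ([]; _∷_; lookup; _[_]≔_)
open import Data.Vec.Properties using ([]=⇒lookup; lookup⇒[]=)
open import Function using (_∘_)
open import Level using (0ℓ)
open import Relation.Binary.Definitions using (tri<; tri≈; tri>)
open import Relation.Binary.PropositionalEquality
  using (_≡_; refl; sym; trans; cong; cong₂; subst; subst₂; module ≡-Reasoning)
open import Relation.Nullary using (¬_; yes; no; does)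
open import Relation.Nullary.Decidable using (dec-true; dec-false)
open import Relation.Unary using (Pred; Decidable)
open Sum ℕₚ.+-*-semiring using (sum; sum-cong-≗; ∑-distrib-+; ∑-comm; *-distribˡ-sum)

-- Sums over Fin n and over words

-- Ties are charged to every resampled position, so these positions must be few; yet they must be
-- numerous enough for a non-twin pair to appear. If `p` is the density of non-twin pairs, about
-- `L / p` positions meet both demands: all pairs are twins with probability at most `1 / (1 + L)`,
-- while `s` positions with `s p ≤ 1 + L` lose at most `s p · 3 / R` to ties. This is why
-- `R = 3 (1 + L)²` is a constant, and with it the distance at which two vertices cease to be twins
-- and finally `C`. If fewer than `L / p` positions are available, then `p = O(L / k)`; in that case
-- Markov's inequality only has to reach 1/2, because 1/2 is the target anyway. Words are used
-- because their letters are independent: deleting a letter leaves a uniform word, so expectations,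
-- tail bounds and ratios of counts all come from double counting a marked position.
-- Anti-concentration is obtained in this way too, by comparing each tie count with nearby counts
-- off the diagonal. Probabilities appear as integer counts with denominators cleared.

sum-mono : ∀ {n} {f g : Fin n → ℕ} → (∀ i → f i ≼ g i) → sum f ≼ sum g
sum-mono {zero}  f≤g = z≤n
sum-mono {suc n} f≤g = ℕₚ.+-mono-≤ (f≤g zero) (sum-mono (f≤g ∘ suc))

sum-+ : ∀ {n} (f g : Fin n → ℕ) → sum (λ i → f i + g i) ≡ sum f + sum g
sum-+ = ∑-distrib-+

sum-comm : ∀ {m n} (f : Fin m → Fin n → ℕ) → sum (λ i → sum (f i)) ≡ sum λ j → sum λ i → f i j
sum-comm = ∑-comm

sum-*ˡ : ∀ {n} c (f : Fin n → ℕ) → sum (λ i → c · f i) ≡ c · sum f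
sum-*ˡ c f = sym (*-distribˡ-sum c f)

sum-const : ∀ n c → sum {n} (λ _ → c) ≡ n · c
sum-const zero    c = refl
sum-const (suc n) c = cong (c +_) (sum-const n c)

along : ∀ {A : Set} → (A → ℕ) → List A → ℕ
along h []      = 0
along h (z ∷ f) = h z + along h f

along-insert : ∀ {A : Set} (h : A → ℕ) p {z r} → along h (p ++ z ∷ r) ≡ h z + along h (p ++ r)
along-insert h []      = refl
along-insert h (x ∷ p) {z} {r} = begin
  h x + along h (p ++ z ∷ r)     ≡⟨ cong (h x +_) (along-insert h p) ⟩
  h x + (h z + along h (p ++ r)) ≡⟨ exchange (h x) (h z) _ ⟩
  h z + (h x + along h (p ++ r)) ∎
  where
  open ≡-Reasoning
  exchange : ∀ a b c → a + (b + c) ≡ b + (a + c)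
  exchange = solve-∀

along-cong : ∀ {A : Set} {g h : A → ℕ} → (∀ z → g z ≡ h z) → ∀ f → along g f ≡ along h f
along-cong g≡h []      = refl
along-cong g≡h (z ∷ f) = cong₂ _+_ (g≡h z) (along-cong g≡h f)

along-+ : ∀ {A : Set} (g h : A → ℕ) f → along (λ z → g z + h z) f ≡ along g f + along h f
along-+ g h []      = refl
along-+ g h (z ∷ f) = trans (cong (g z + h z +_) (along-+ g h f)) (interchange (g z) (h z) _ _)
  where
  interchange : ∀ a b c d → (a + b) + (c + d) ≡ (a + c) + (b + d)
  interchange = solve-∀

along-*ʳ : ∀ {A : Set} (h : A → ℕ) c f → along (λ z → h z · c) f ≡ along h f · c
along-*ʳ h c []      = refl
along-*ʳ h c (z ∷ f) = trans (cong (h z · c +_) (along-*ʳ h c f)) (sym (ℕₚ.*-distribʳ-+ c (h z) _))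

along-*ˡ : ∀ {A : Set} c (h : A → ℕ) f → along (λ z → c · h z) f ≡ c · along h f
along-*ˡ c h []      = sym (ℕₚ.*-zeroʳ c)
along-*ˡ c h (z ∷ f) = trans (cong (c · h z +_) (along-*ˡ c h f)) (sym (ℕₚ.*-distribˡ-+ c (h z) _))

along-const : ∀ {A : Set} c (f : List A) → along (λ _ → c) f ≡ length f · c
along-const c []      = refl
along-const c (z ∷ f) = cong (c +_) (along-const c f)

along-mono : ∀ {A : Set} {g h : A → ℕ} → (∀ z → g z ≼ h z) → ∀ f → along g f ≼ along h f
along-mono g≤h []      = z≤n
along-mono g≤h (z ∷ f) = ℕₚ.+-mono-≤ (g≤h z) (along-mono g≤h f)

along-comm : ∀ {A B : Set} (g : A → B → ℕ) e f →
             along (λ a → along (g a) f) e ≡ along (λ b → along (λ a → g a b) e) f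
along-comm g []      f = sym (trans (along-const 0 f) (ℕₚ.*-zeroʳ (length f)))
along-comm g (a ∷ e) f = trans (cong (along (g a) f +_) (along-comm g e f)) (sym (along-+ (g a) _ f))

-- Over `n ^ m` this is the expectation over a uniform word of length `m`, repeated letters allowed.
∑ʷ : ∀ {n} → ℕ → (List (Fin n) → ℕ) → ℕ
∑ʷ zero    F = F []
∑ʷ (suc m) F = sum λ z → ∑ʷ m λ f → F (z ∷ f)

module _ {n : ℕ} where

  ∑ʷ-mono-length : ∀ m {F G : List (Fin n) → ℕ} → (∀ f → length f ≡ m → F f ≼ G f) → ∑ʷ m F ≼ ∑ʷ m G
  ∑ʷ-mono-length zero    F≤G = F≤G [] refl
  ∑ʷ-mono-length (suc m) F≤G = sum-mono λ z → ∑ʷ-mono-length m λ f eq → F≤G (z ∷ f) (cong suc eq)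

  ∑ʷ-mono : ∀ m {F G : List (Fin n) → ℕ} → (∀ f → F f ≼ G f) → ∑ʷ m F ≼ ∑ʷ m G
  ∑ʷ-mono m F≤G = ∑ʷ-mono-length m λ f _ → F≤G f

  ∑ʷ-cong : ∀ m {F G : List (Fin n) → ℕ} → (∀ f → F f ≡ G f) → ∑ʷ m F ≡ ∑ʷ m G
  ∑ʷ-cong zero    F≡G = F≡G []
  ∑ʷ-cong (suc m) F≡G = sum-cong-≗ λ z → ∑ʷ-cong m λ f → F≡G (z ∷ f)

  ∑ʷ-+ : ∀ m (F G : List (Fin n) → ℕ) → ∑ʷ m (λ f → F f + G f) ≡ ∑ʷ m F + ∑ʷ m G
  ∑ʷ-+ zero    F G = refl
  ∑ʷ-+ (suc m) F G = trans (sum-cong-≗ λ z → ∑ʷ-+ m (F ∘ (z ∷_)) (G ∘ (z ∷_)))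
    (sum-+ (λ z → ∑ʷ m (F ∘ (z ∷_))) λ z → ∑ʷ m (G ∘ (z ∷_)))

  ∑ʷ-*ˡ : ∀ m c (F : List (Fin n) → ℕ) → ∑ʷ m (λ f → c · F f) ≡ c · ∑ʷ m F
  ∑ʷ-*ˡ zero    c F = refl
  ∑ʷ-*ˡ (suc m) c F = trans (sum-cong-≗ λ z → ∑ʷ-*ˡ m c (F ∘ (z ∷_)))
    (sum-*ˡ c λ z → ∑ʷ m (F ∘ (z ∷_)))

  ∑ʷ-const : ∀ m c → ∑ʷ {n} m (λ _ → c) ≡ c · n ^ m
  ∑ʷ-const zero    c = sym (ℕₚ.*-identityʳ c)
  ∑ʷ-const (suc m) c = begin
    sum {n} (λ _ → ∑ʷ {n} m (λ _ → c)) ≡⟨ sum-const n _ ⟩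
    n · ∑ʷ {n} m (λ _ → c)             ≡⟨ cong (n ·_) (∑ʷ-const m c) ⟩
    n · (c · n ^ m)                    ≡⟨ exchange n c (n ^ m) ⟩
    c · (n · n ^ m)                    ∎
    where
    open ≡-Reasoning
    exchange : ∀ a b c → a · (b · c) ≡ b · (a · c)
    exchange = solve-∀

  ∑ʷ-sum : ∀ {l} m (F : Fin l → List (Fin n) → ℕ) →
           ∑ʷ m (λ f → sum λ z → F z f) ≡ sum λ z → ∑ʷ m (F z)
  ∑ʷ-sum zero    F = refl
  ∑ʷ-sum (suc m) F = trans (sum-cong-≗ λ x → ∑ʷ-sum m λ z f → F z (x ∷ f))
    (sum-comm λ x z → ∑ʷ m (F z ∘ (x ∷_)))

  -- Each of the m + 1 positions of a random word carries an independent random letter.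
  ∑ʷ-pick : ∀ m (F H : Fin n → List (Fin n) → ℕ) →
            (∀ p z r → F z (p ++ z ∷ r) ≡ H z (p ++ r)) →
            ∑ʷ (suc m) (λ f → along (λ z → F z f) f) ≡ suc m · sum λ z → ∑ʷ m (H z)
  ∑ʷ-pick m F H F≡H = begin
    sum (λ x → ∑ʷ m λ f → F x (x ∷ f) + along (λ z → F z (x ∷ f)) f)
      ≡⟨ sum-cong-≗ (λ x → ∑ʷ-+ m (λ f → F x (x ∷ f)) _) ⟩
    sum (λ x → ∑ʷ m (λ f → F x (x ∷ f)) + ∑ʷ m (λ f → along (λ z → F z (x ∷ f)) f))
      ≡⟨ sum-+ _ (λ x → ∑ʷ m (λ f → along (λ z → F z (x ∷ f)) f)) ⟩
    sum (λ x → ∑ʷ m (λ f → F x (x ∷ f))) + sum (λ x → ∑ʷ m (λ f → along (λ z → F z (x ∷ f)) f))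
      ≡⟨ cong₂ _+_ (sum-cong-≗ λ x → ∑ʷ-cong m λ f → F≡H [] x f) (rest m F H F≡H) ⟩
    suc m · sum (λ z → ∑ʷ m (H z)) ∎
    where
    open ≡-Reasoning
    -- Once the head is split off, its letter becomes part of the fixed context of the shorter word,
    -- which allows induction over all `F` and `H`.
    rest : ∀ m (F H : Fin n → List (Fin n) → ℕ) → (∀ p z r → F z (p ++ z ∷ r) ≡ H z (p ++ r)) →
           sum (λ x → ∑ʷ m (λ f → along (λ z → F z (x ∷ f)) f)) ≡ m · sum λ z → ∑ʷ m (H z)
    rest zero    F H F≡H = trans (sum-const n 0) (ℕₚ.*-zeroʳ n)
    rest (suc m) F H F≡H = begin
      sum (λ x → ∑ʷ (suc m) (λ f → along (λ z → F z (x ∷ f)) f))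
        ≡⟨ sum-cong-≗ (λ x → ∑ʷ-pick m (λ z f → F z (x ∷ f)) (λ z f → H z (x ∷ f)) λ p → F≡H (x ∷ p)) ⟩
      sum (λ x → suc m · sum (λ z → ∑ʷ m (λ f → H z (x ∷ f))))
        ≡⟨ sum-*ˡ (suc m) (λ x → sum (λ z → ∑ʷ m (λ f → H z (x ∷ f)))) ⟩
      suc m · sum (λ x → sum (λ z → ∑ʷ m (λ f → H z (x ∷ f))))
        ≡⟨ cong (suc m ·_) (sum-comm λ x z → ∑ʷ m (λ f → H z (x ∷ f))) ⟩
      suc m · sum (λ z → ∑ʷ (suc m) (H z)) ∎

-- Indicators

χ : Bool → ℕ
χ true  = 1
χ false = 0

χ≤1 : ∀ b → χ b ≼ 1
χ≤1 true  = ℕₚ.≤-refl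
χ≤1 false = z≤n

δ : ℕ → ℕ → ℕ
δ a b = χ (a ℕ.≡ᵇ b)

δ-refl : ∀ a → δ a a ≡ 1
δ-refl zero    = refl
δ-refl (suc a) = δ-refl a

δ-≢ : ∀ {a b} → ¬ a ≡ b → δ a b ≡ 0
δ-≢ {zero}  {zero}  a≢b = ⊥-elim (a≢b refl)
δ-≢ {zero}  {suc b} a≢b = refl
δ-≢ {suc a} {zero}  a≢b = refl
δ-≢ {suc a} {suc b} a≢b = δ-≢ (a≢b ∘ cong suc)

δ-subst : ∀ (g : ℕ → ℕ) a b → g a · δ a b ≡ g b · δ a b
δ-subst g a b with a ℕ.≟ b
... | yes refl = refl
... | no a≢b rewrite δ-≢ a≢b = trans (ℕₚ.*-zeroʳ (g a)) (sym (ℕₚ.*-zeroʳ (g b)))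

term≤sum : ∀ {n} (f : Fin n → ℕ) i → f i ≼ sum f
term≤sum f zero    = ℕₚ.m≤m+n _ _
term≤sum f (suc i) = ℕₚ.≤-trans (term≤sum (f ∘ suc) i) (ℕₚ.m≤n+m _ _)

sum-δ≤1 : ∀ {l} a (g : Fin l → ℕ) → (∀ i j → g i ≡ g j → i ≡ j) → sum (λ i → δ a (g i)) ≼ 1
sum-δ≤1 {zero}  a g inj = z≤n
sum-δ≤1 {suc l} a g inj with a ℕ.≟ g zero
... | yes refl = ℕₚ.+-mono-≤ (χ≤1 (g zero ℕ.≡ᵇ g zero)) (ℕₚ.≤-reflexive
        (trans (sum-cong-≗ λ i → δ-≢ λ eq → 0≢suc (inj zero (suc i) eq))
          (trans (sum-const l 0) (ℕₚ.*-zeroʳ l))))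
  where
  0≢suc : ∀ {n} {i : Fin n} → ¬ Fin.zero ≡ suc i
  0≢suc ()
... | no a≢ rewrite δ-≢ a≢ = sum-δ≤1 a (g ∘ suc) λ i j eq → Fin.suc-injective (inj (suc i) (suc j) eq)

-- Anti-concentration: ties between two disjoint classes of letters

module AntiConcentration {n : ℕ} (α β : Fin n → Bool)
  (disjoint : ∀ z → α z ≡ true → β z ≡ true → ⊥) where

  #α #β : List (Fin n) → ℕ
  #α = along (χ ∘ α)
  #β = along (χ ∘ β)

  P M : ℕ
  P = sum (χ ∘ α)
  M = sum (χ ∘ β)

  N : ℕ → ℕ → ℕ → ℕ
  N m a b = ∑ʷ m λ f → δ (#β f) b · δ (#α f) a

  -- Double counting of words with a marked letter from γ: deleting it leaves a word with one such
  -- letter fewer, and it can be restored in any of `suc m` positions by any element of γ. The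
  -- weight ψ does not see letters from γ.
  count-suc : ∀ m b (γ : Fin n → Bool) (ψ : List (Fin n) → ℕ) →
    (∀ p z r → γ z ≡ true → ψ (p ++ z ∷ r) ≡ ψ (p ++ r)) →
    suc b · ∑ʷ (suc m) (λ f → δ (along (χ ∘ γ) f) (suc b) · ψ f)
      ≡ suc m · (sum (χ ∘ γ) · ∑ʷ m (λ f → δ (along (χ ∘ γ) f) b · ψ f))
  count-suc m b γ ψ ψ-insert = begin
    suc b · ∑ʷ (suc m) X                                ≡⟨ ∑ʷ-*ˡ (suc m) (suc b) X ⟨
    ∑ʷ (suc m) (λ f → suc b · X f)                      ≡⟨ ∑ʷ-cong (suc m) weigh ⟩
    ∑ʷ (suc m) (λ f → along (λ z → χ (γ z) · X f) f)    ≡⟨ ∑ʷ-pick m (λ z f → χ (γ z) · X f) (λ z f → χ (γ z) · Y f) insert ⟩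
    suc m · sum (λ z → ∑ʷ m (λ f → χ (γ z) · Y f))      ≡⟨ cong (suc m ·_) (sum-cong-≗ λ z → ∑ʷ-*ˡ m (χ (γ z)) Y) ⟩
    suc m · sum (λ z → χ (γ z) · ∑ʷ m Y)                ≡⟨ cong (suc m ·_) (sum-*ʳ (χ ∘ γ) (∑ʷ m Y)) ⟩
    suc m · (sum (χ ∘ γ) · ∑ʷ m Y)                      ∎
    where
    open ≡-Reasoning
    X Y : List (Fin n) → ℕ
    X f = δ (along (χ ∘ γ) f) (suc b) · ψ f
    Y f = δ (along (χ ∘ γ) f) b · ψ f
    sum-*ʳ : ∀ {n} (f : Fin n → ℕ) c → sum (λ i → f i · c) ≡ sum f · c
    sum-*ʳ f c = trans (sum-cong-≗ λ i → ℕₚ.*-comm (f i) c) (trans (sum-*ˡ c f) (ℕₚ.*-comm c _))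
    weigh : ∀ f → suc b · X f ≡ along (λ z → χ (γ z) · X f) f
    weigh f = begin
      suc b · (δ c (suc b) · ψ f) ≡⟨ ℕₚ.*-assoc (suc b) (δ c (suc b)) (ψ f) ⟨
      suc b · δ c (suc b) · ψ f   ≡⟨ cong (_· ψ f) (δ-subst (λ x → x) c (suc b)) ⟨
      c · δ c (suc b) · ψ f       ≡⟨ ℕₚ.*-assoc c (δ c (suc b)) (ψ f) ⟩
      c · X f                     ≡⟨ along-*ʳ (χ ∘ γ) (X f) f ⟨
      along (λ z → χ (γ z) · X f) f ∎
      where c = along (χ ∘ γ) f
    insert : ∀ p z r → χ (γ z) · X (p ++ z ∷ r) ≡ χ (γ z) · Y (p ++ r)
    insert p z r rewrite along-insert (χ ∘ γ) p {z} {r} with γ z in γz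
    ... | false = refl
    ... | true  = cong (λ t → δ (along (χ ∘ γ) (p ++ r)) b · t + 0) (ψ-insert p z r γz)

  -- Deleting a marked β-letter on the left and a marked α-letter on the right leaves the same
  -- words. The two sides then differ only in the factors `M` and `P`, the numbers of letters that
  -- can be put back.
  count-step : M ≼ P → ∀ m a b → suc b · N m a (suc b) ≼ suc a · N m (suc a) b
  count-step M≤P zero    a b = ℕₚ.≤-trans (ℕₚ.≤-reflexive (ℕₚ.*-zeroʳ (suc b))) z≤n
  count-step M≤P (suc m) a b = begin
    suc b · N (suc m) a (suc b)      ≡⟨ count-suc m b β (λ f → δ (#α f) a) (λ p z r βz → cong (λ t → δ t a) (skip α β (λ z → disjoint z) p z r βz)) ⟩
    suc m · (M · N m a b)            ≤⟨ ℕₚ.*-monoʳ-≤ (suc m) (ℕₚ.*-monoˡ-≤ (N m a b) M≤P) ⟩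
    suc m · (P · N m a b)            ≡⟨ cong (λ t → suc m · (P · t)) (swap m a b) ⟩
    suc m · (P · ∑ʷ m (λ f → δ (#α f) a · δ (#β f) b))
      ≡⟨ count-suc m a α (λ f → δ (#β f) b) (λ p z r αz → cong (λ t → δ t b) (skip β α (λ z bz az → disjoint z az bz) p z r αz)) ⟨
    suc a · ∑ʷ (suc m) (λ f → δ (#α f) (suc a) · δ (#β f) b) ≡⟨ cong (suc a ·_) (swap (suc m) (suc a) b) ⟨
    suc a · N (suc m) (suc a) b      ∎
    where
    open ≤-Reasoning
    swap : ∀ m a b → N m a b ≡ ∑ʷ m (λ f → δ (#α f) a · δ (#β f) b)
    swap m a b = ∑ʷ-cong m λ f → ℕₚ.*-comm (δ (#β f) b) (δ (#α f) a)
    skip : ∀ (γ ε : Fin n → Bool) → (∀ z → γ z ≡ true → ε z ≡ true → ⊥) → ∀ p z r → ε z ≡ true →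
           along (χ ∘ γ) (p ++ z ∷ r) ≡ along (χ ∘ γ) (p ++ r)
    skip γ ε dis p z r εz rewrite along-insert (χ ∘ γ) p {z} {r} with γ z in γz
    ... | false = refl
    ... | true  = ⊥-elim (dis z γz εz)

  -- Off the diagonal the counts decay slowly: as long as j ≥ R², N (j + i) (j - i) is at least (1 - i/R) N j j.
  count-chain : M ≼ P → ∀ m R i e b → e + i ≡ R → R · R ≼ b + i →
                e · N m (b + i) (b + i) ≼ R · N m (b + i + i) b
  count-chain M≤P m R zero e b e≡R _
    rewrite ℕₚ.+-identityʳ b | ℕₚ.+-identityʳ b | ℕₚ.+-identityʳ e | e≡R = ℕₚ.≤-refl
  count-chain M≤P m R (suc i) e b e+i≡R R²≤j
    rewrite ℕₚ.+-suc b i | ℕₚ.+-suc (b + i) i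
    = ℕₚ.*-cancelˡ-≤ (suc e · suc a) (begin
      suc e · suc a · (e · X)       ≡⟨ shuffle₁ (suc e) (suc a) e X ⟩
      suc a · e · (suc e · X)       ≤⟨ ℕₚ.*-monoʳ-≤ (suc a · e) (count-chain M≤P m R i (suc e) (suc b) (trans (sym (ℕₚ.+-suc e i)) e+i≡R) R²≤j) ⟩
      -- One step away from the diagonal multiplies the count by at least `suc b / suc a`. As
      -- `b + i` is at least about `R²`, this is at least `e / suc e`, and these factors telescope
      -- to `e / R`.
      suc a · e · (R · Y)           ≤⟨ ℕₚ.*-monoˡ-≤ (R · Y) (ratio e i b R e+i≡R R²≤j) ⟩
      suc e · suc b · (R · Y)       ≡⟨ shuffle₂ (suc e) (suc b) R Y ⟩
      suc e · R · (suc b · Y)       ≤⟨ ℕₚ.*-monoʳ-≤ (suc e · R) (count-step M≤P m a b) ⟩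
      suc e · R · (suc a · Z)       ≡⟨ shuffle₃ (suc e) R (suc a) Z ⟩
      suc e · suc a · (R · Z)       ∎)
    where
    open ≤-Reasoning
    a = suc (b + i + i)
    X = N m (suc (b + i)) (suc (b + i))
    Y = N m a (suc b)
    Z = N m (suc a) b
    shuffle₁ : ∀ a b c d → a · b · (c · d) ≡ b · c · (a · d)
    shuffle₁ = solve-∀
    shuffle₂ : ∀ a b c d → a · b · (c · d) ≡ a · c · (b · d)
    shuffle₂ = solve-∀
    shuffle₃ : ∀ a b c d → a · b · (c · d) ≡ a · c · (b · d)
    shuffle₃ = solve-∀
    ratio : ∀ e i b R → e + suc i ≡ R → R · R ≼ suc (b + i) → suc (suc (b + i + i)) · e ≼ suc e · suc b
    ratio e i b .(e + suc i) refl R²≤ = ℕₚ.+-cancelˡ-≤ i _ _ (begin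
      i + suc (suc (b + i + i)) · e                    ≡⟨ expand₁ e i b ⟩
      i + e · suc (i + i) + (e · suc b)                ≤⟨ ℕₚ.+-monoˡ-≤ (e · suc b) (ℕₚ.m≤m+n (i + e · suc (i + i)) (e · e + i · i + e + i + 1)) ⟩
      i + e · suc (i + i) + (e · e + i · i + e + i + 1) + e · suc b ≡⟨ cong (_+ e · suc b) (expand₂ e i) ⟩
      (e + suc i) · (e + suc i) + e · suc b            ≤⟨ ℕₚ.+-monoˡ-≤ (e · suc b) R²≤ ⟩
      suc (b + i) + e · suc b                          ≡⟨ expand₃ e i b ⟩
      i + suc e · suc b                                ∎)
      where
      expand₁ : ∀ e i b → i + suc (suc (b + i + i)) · e ≡ i + e · suc (i + i) + (e · suc b)
      expand₁ = solve-∀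
      expand₂ : ∀ e i → i + e · suc (i + i) + (e · e + i · i + e + i + 1) ≡ (e + suc i) · (e + suc i)
      expand₂ = solve-∀
      expand₃ : ∀ e i b → suc (b + i) + e · suc b ≡ i + suc e · suc b
      expand₃ = solve-∀

  w : Fin n → ℕ
  w z = χ (α z) + χ (β z)

  -- Inserting a letter from α or β into a word with fewer than `J` hits gives a word with at most
  -- `J` hits, which arises in this way at most `J` times. This double counting takes the place of a
  -- variance estimate.
  few-hits : ∀ m J → suc m · (P + M) · ∑ʷ m (λ f → χ (along w f ℕ.<ᵇ J)) ≼ J · n ^ suc m
  few-hits m J = begin
    suc m · (P + M) · ∑ʷ m Y                                        ≡⟨ ℕₚ.*-assoc (suc m) (P + M) (∑ʷ m Y) ⟩
    suc m · ((P + M) · ∑ʷ m Y)                                      ≡⟨ cong (λ t → suc m · (t · ∑ʷ m Y)) (sum-+ (χ ∘ α) (χ ∘ β)) ⟨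
    suc m · (sum w · ∑ʷ m Y)                                        ≡⟨ cong (suc m ·_) (ℕₚ.*-comm (sum w) _) ⟩
    suc m · (∑ʷ m Y · sum w)                                        ≡⟨ cong (suc m ·_) (sum-*ˡ (∑ʷ m Y) w) ⟨
    suc m · sum (λ z → ∑ʷ m Y · w z)                                ≡⟨ cong (suc m ·_) (sum-cong-≗ λ z → trans (ℕₚ.*-comm _ (w z)) (sym (∑ʷ-*ˡ m (w z) Y))) ⟩
    suc m · sum (λ z → ∑ʷ m (λ f → w z · Y f))                      ≡⟨ ∑ʷ-pick m (λ z f → w z · X f) (λ z f → w z · Y f) insert ⟨
    ∑ʷ (suc m) (λ f → along (λ z → w z · X f) f)                    ≤⟨ ∑ʷ-mono (suc m) bound ⟩
    ∑ʷ {n} (suc m) (λ _ → J)                                        ≡⟨ ∑ʷ-const {n} (suc m) J ⟩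
    J · n ^ suc m                                                   ∎
    where
    open ≤-Reasoning
    X Y : List (Fin n) → ℕ
    X f = χ (along w f ℕ.<ᵇ suc J)
    Y f = χ (along w f ℕ.<ᵇ J)
    insert : ∀ p z r → w z · X (p ++ z ∷ r) ≡ w z · Y (p ++ r)
    insert p z r rewrite along-insert w p {z} {r} with α z in αz | β z in βz
    ... | false | false = refl
    ... | false | true  = refl
    ... | true  | false = refl
    ... | true  | true  = ⊥-elim (disjoint z αz βz)
    ·χ<≤ : ∀ a J → a · χ (a ℕ.<ᵇ suc J) ≼ J
    ·χ<≤ a J with a ℕ.<ᵇ suc J in lt
    ... | false = ℕₚ.≤-trans (ℕₚ.≤-reflexive (ℕₚ.*-zeroʳ a)) z≤n
    ... | true  = ℕₚ.≤-trans (ℕₚ.≤-reflexive (ℕₚ.*-identityʳ a))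
                    (ℕₚ.≤-pred (ℕₚ.<ᵇ⇒< a (suc J) (subst Bool.T (sym lt) _)))
    bound : ∀ f → along (λ z → w z · X f) f ≼ J
    bound f = ℕₚ.≤-trans (ℕₚ.≤-reflexive (along-*ʳ w (X f) f)) (·χ<≤ (along w f) J)

  -- By `count-chain` for `R + R`, each diagonal count is at most twice the count at each of `R`
  -- points on its antidiagonal; `J` is the height that this requires. All these points are
  -- distinct, so their counts add up to at most `n ^ m`.
  few-diagonal : M ≼ P → ∀ m R l .{{_ : ℕ.NonZero R}} → let J = (R + R) · (R + R) in
    R · sum {l} (λ t → N m (J + toℕ t) (J + toℕ t)) ≼ 2 · n ^ m
  few-diagonal M≤P m R l = begin
    R · sum {l} (λ t → N m (J + toℕ t) (J + toℕ t))
      ≡⟨ sum-const R _ ⟨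
    sum {R} (λ i → sum {l} (λ t → N m (J + toℕ t) (J + toℕ t)))
      ≤⟨ sum-mono (λ i → sum-mono (λ t → double i t)) ⟩
    sum {R} (λ i → sum {l} (λ t → 2 · N m (b i t + toℕ i + toℕ i) (b i t)))
      ≡⟨ sum-cong-≗ (λ i → sum-*ˡ 2 (λ t → N m (b i t + toℕ i + toℕ i) (b i t))) ⟩
    sum {R} (λ i → 2 · sum {l} (λ t → N m (b i t + toℕ i + toℕ i) (b i t)))
      ≡⟨ sum-*ˡ 2 (λ i → sum {l} (λ t → N m (b i t + toℕ i + toℕ i) (b i t))) ⟩
    2 · sum {R} (λ i → sum {l} (λ t → N m (b i t + toℕ i + toℕ i) (b i t)))
      ≡⟨ cong (2 ·_) (trans (∑ʷ-sum m (λ i f → sum {l} (λ t → D i t f)))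
           (sum-cong-≗ λ i → ∑ʷ-sum m (D i))) ⟨
    2 · ∑ʷ m (λ f → sum {R} (λ i → sum {l} (λ t → D i t f)))
      ≤⟨ ℕₚ.*-monoʳ-≤ 2 (∑ʷ-mono m disjoint-events) ⟩
    2 · ∑ʷ {n} m (λ _ → 1)
      ≡⟨ cong (2 ·_) (trans (∑ʷ-const {n} m 1) (ℕₚ.*-identityˡ (n ^ m))) ⟩
    2 · n ^ m ∎
    where
    open ≤-Reasoning
    J = (R + R) · (R + R)
    b : Fin R → Fin l → ℕ
    b i t = (J ∸ toℕ i) + toℕ t
    D : Fin R → Fin l → List (Fin n) → ℕ
    D i t f = δ (#β f) (b i t) · δ (#α f) (b i t + toℕ i + toℕ i)
    i≤R : ∀ (i : Fin R) → toℕ i ≼ R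
    i≤R i = ℕₚ.<⇒≤ (Fin.toℕ<n i)
    R≤J : R ≼ J
    R≤J = ℕₚ.≤-trans (ℕₚ.m≤m+n R R) (ℕₚ.m≤m*n (R + R) (R + R) )
      where instance
        _ : ℕ.NonZero (R + R)
        _ = ℕ.>-nonZero (ℕₚ.<-≤-trans (ℕ.>-nonZero⁻¹ R) (ℕₚ.m≤m+n R R))
    b+i : ∀ i t → b i t + toℕ i ≡ J + toℕ t
    b+i i t = trans (swap (J ∸ toℕ i) (toℕ t) (toℕ i))
      (cong (_+ toℕ t) (ℕₚ.m∸n+n≡m (ℕₚ.≤-trans (i≤R i) R≤J)))
      where
      swap : ∀ x y z → x + y + z ≡ x + z + y
      swap = solve-∀
    double : ∀ i t → N m (J + toℕ t) (J + toℕ t) ≼ 2 · N m (b i t + toℕ i + toℕ i) (b i t)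
    double i t = ℕₚ.*-cancelˡ-≤ R (begin
      R · N m (J + toℕ t) (J + toℕ t)              ≤⟨ ℕₚ.*-monoˡ-≤ (N m (J + toℕ t) (J + toℕ t)) R≤e ⟩
      e · N m (J + toℕ t) (J + toℕ t)              ≡⟨ cong (λ j → e · N m j j) (b+i i t) ⟨
      e · N m (b i t + toℕ i) (b i t + toℕ i)      ≤⟨ count-chain M≤P m (R + R) (toℕ i) e (b i t) (ℕₚ.m∸n+n≡m (ℕₚ.≤-trans (i≤R i) (ℕₚ.m≤m+n R R)))
                                                     (subst (J ≼_) (sym (b+i i t)) (ℕₚ.m≤m+n J (toℕ t))) ⟩
      (R + R) · N m (b i t + toℕ i + toℕ i) (b i t) ≡⟨ regroup R _ ⟩
      R · (2 · N m (b i t + toℕ i + toℕ i) (b i t)) ∎)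
      where
      e = (R + R) ∸ toℕ i
      R≤e : R ≼ e
      R≤e = ℕₚ.≤-trans (ℕₚ.≤-reflexive (sym (ℕₚ.m+n∸n≡m R R))) (ℕₚ.∸-monoʳ-≤ (R + R) (i≤R i))
      regroup : ∀ r x → (r + r) · x ≡ r · (2 · x)
      regroup = solve-∀
    -- The difference #α - #β determines i, and then #β determines t.
    disjoint-events : ∀ f → sum {R} (λ i → sum {l} (λ t → D i t f)) ≼ 1
    disjoint-events f = begin
      sum {R} (λ i → sum {l} (λ t → D i t f))
        ≡⟨ sum-cong-≗ (λ i → sum-cong-≗ λ t → decouple i t) ⟩
      sum {R} (λ i → sum {l} (λ t → δ (#α f) (#β f + toℕ i + toℕ i) · δ (#β f) (b i t)))
        ≡⟨ sum-cong-≗ (λ i → sum-*ˡ (δ (#α f) (#β f + toℕ i + toℕ i)) (λ t → δ (#β f) (b i t))) ⟩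
      sum {R} (λ i → δ (#α f) (#β f + toℕ i + toℕ i) · sum {l} (λ t → δ (#β f) (b i t)))
        ≤⟨ sum-mono (λ i → ℕₚ.≤-trans (ℕₚ.*-monoʳ-≤ (δ (#α f) (#β f + toℕ i + toℕ i))
             (sum-δ≤1 (#β f) (b i) λ s t eq → Fin.toℕ-injective (ℕₚ.+-cancelˡ-≡ (J ∸ toℕ i) _ _ eq)))
             (ℕₚ.≤-reflexive (ℕₚ.*-identityʳ _))) ⟩
      sum {R} (λ i → δ (#α f) (#β f + toℕ i + toℕ i))
        ≤⟨ sum-δ≤1 {R} (#α f) (λ i → #β f + toℕ i + toℕ i) shift-injective ⟩
      1 ∎
      where
      decouple : ∀ i t → D i t f ≡ δ (#α f) (#β f + toℕ i + toℕ i) · δ (#β f) (b i t)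
      decouple i t = trans (ℕₚ.*-comm (δ (#β f) (b i t)) _)
        (sym (δ-subst (λ x → δ (#α f) (x + toℕ i + toℕ i)) (#β f) (b i t)))
      shift-injective : ∀ i j → #β f + toℕ i + toℕ i ≡ #β f + toℕ j + toℕ j → i ≡ j
      shift-injective i j eq = Fin.toℕ-injective (ℕₚ.*-cancelˡ-≡ (toℕ i) (toℕ j) 2
        (ℕₚ.+-cancelˡ-≡ (#β f) _ _ (trans (regroup (#β f) (toℕ i)) (trans eq (sym (regroup (#β f) (toℕ j)))))))
        where
        regroup : ∀ x y → x + 2 · y ≡ x + y + y
        regroup = solve-∀

  -- A tie either has fewer than `J + J` hits in total, at cost `1 / R` by `few-hits`, or lies on
  -- the diagonal at height at least `J`, at cost `2 / R` by `few-diagonal`.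
  few-ties-ordered : M ≼ P → ∀ m R .{{_ : ℕ.NonZero R}} .{{_ : ℕ.NonZero n}} → let J = (R + R) · (R + R) in
    (J + J) · R · n ≼ suc m · (P + M) → R · ∑ʷ m (λ f → δ (#α f) (#β f)) ≼ 3 · n ^ m
  few-ties-ordered M≤P m R big = begin
    R · ∑ʷ m (λ f → δ (#α f) (#β f))      ≤⟨ ℕₚ.*-monoʳ-≤ R (∑ʷ-mono-length m split) ⟩
    R · ∑ʷ m (λ f → Lo f + Hi f)          ≡⟨ cong (R ·_) (trans (∑ʷ-+ m Lo Hi) (cong (∑ʷ m Lo +_) (∑ʷ-sum m Hi-at))) ⟩
    R · (∑ʷ m Lo + sum {suc m} (λ t → N m (J + toℕ t) (J + toℕ t)))
                                          ≡⟨ ℕₚ.*-distribˡ-+ R (∑ʷ m Lo) _ ⟩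
    R · ∑ʷ m Lo + R · sum {suc m} (λ t → N m (J + toℕ t) (J + toℕ t))
                                          ≤⟨ ℕₚ.+-mono-≤ low (few-diagonal M≤P m R (suc m)) ⟩
    n ^ m + 2 · n ^ m                     ∎
    where
    open ≤-Reasoning
    J = (R + R) · (R + R)
    instance
      _ : ℕ.NonZero (R + R)
      _ = ℕ.>-nonZero (ℕₚ.<-≤-trans (ℕ.>-nonZero⁻¹ R) (ℕₚ.m≤m+n R R))
      J≢0 : ℕ.NonZero J
      J≢0 = ℕₚ.m*n≢0 (R + R) (R + R)
      _ : ℕ.NonZero (J + J)
      _ = ℕ.>-nonZero (ℕₚ.<-≤-trans (ℕ.>-nonZero⁻¹ J) (ℕₚ.m≤m+n J J))
      _ : ℕ.NonZero ((J + J) · n)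
      _ = ℕₚ.m*n≢0 (J + J) n
    Lo Hi : List (Fin n) → ℕ
    Hi-at : Fin (suc m) → List (Fin n) → ℕ
    Lo f = χ (along w f ℕ.<ᵇ J + J)
    Hi-at t f = δ (#β f) (J + toℕ t) · δ (#α f) (J + toℕ t)
    Hi f = sum {suc m} (λ t → Hi-at t f)
    low : R · ∑ʷ m Lo ≼ n ^ m
    low = ℕₚ.*-cancelˡ-≤ ((J + J) · n) (begin
      (J + J) · n · (R · ∑ʷ m Lo)      ≡⟨ shuffle (J + J) n R _ ⟩
      (J + J) · R · n · ∑ʷ m Lo        ≤⟨ ℕₚ.*-monoˡ-≤ (∑ʷ m Lo) big ⟩
      suc m · (P + M) · ∑ʷ m Lo        ≤⟨ few-hits m (J + J) ⟩
      (J + J) · (n · n ^ m)            ≡⟨ ℕₚ.*-assoc (J + J) n (n ^ m) ⟨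
      (J + J) · n · n ^ m              ∎)
      where
      shuffle : ∀ a b c d → a · b · (c · d) ≡ a · c · b · d
      shuffle = solve-∀
    #β≤length : ∀ f → #β f ≼ length f
    #β≤length f = ℕₚ.≤-trans (along-mono (λ z → χ≤1 (β z)) f)
      (ℕₚ.≤-reflexive (trans (along-const 1 f) (ℕₚ.*-identityʳ (length f))))
    split : ∀ f → length f ≡ m → δ (#α f) (#β f) ≼ Lo f + Hi f
    split f |f|≡m with #α f ℕ.≟ #β f
    ... | no a≢b rewrite δ-≢ a≢b = z≤n
    ... | yes a≡b with J ℕ.≤? #β f
    ...   | yes J≤b = ℕₚ.≤-trans (ℕₚ.≤-trans (ℕₚ.≤-reflexive hit) (term≤sum (λ t → Hi-at t f) t)) (ℕₚ.m≤n+m (Hi f) (Lo f))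
      where
      -- The height above `J` fits into `Fin (suc m)` because a word of length `m` has at most `m`
      -- letters in β.
      t = fromℕ< {#β f ∸ J} (s≤s (ℕₚ.≤-trans (ℕₚ.m∸n≤m (#β f) J) (subst (#β f ≼_) |f|≡m (#β≤length f))))
      J+t : J + toℕ t ≡ #β f
      J+t = trans (cong (J +_) (Fin.toℕ-fromℕ< _)) (ℕₚ.m+[n∸m]≡n J≤b)
      hit : δ (#α f) (#β f) ≡ Hi-at t f
      hit rewrite J+t | a≡b | δ-refl (#β f) = refl
    ...   | no J≰b with along w f ℕ.<ᵇ J + J in eq
    ...     | true  = ℕₚ.≤-trans (χ≤1 (#α f ℕ.≡ᵇ #β f)) (ℕₚ.m≤m+n 1 (Hi f))
    ...     | false = ⊥-elim (subst Bool.T eq (ℕₚ.<⇒<ᵇ (begin-strict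
        along w f          ≡⟨ along-+ (χ ∘ α) (χ ∘ β) f ⟩
        #α f + #β f        ≡⟨ cong (_+ #β f) a≡b ⟩
        #β f + #β f        <⟨ ℕₚ.+-mono-< (ℕₚ.≰⇒> J≰b) (ℕₚ.≰⇒> J≰b) ⟩
        J + J              ∎)))

few-ties : ∀ {n} (α β : Fin n → Bool) → (∀ z → α z ≡ true → β z ≡ true → ⊥) →
  ∀ m R .{{_ : ℕ.NonZero R}} .{{_ : ℕ.NonZero n}} → let J = (R + R) · (R + R) in
  (J + J) · R · n ≼ suc m · (sum (χ ∘ α) + sum (χ ∘ β)) →
  R · ∑ʷ m (λ f → δ (along (χ ∘ α) f) (along (χ ∘ β) f)) ≼ 3 · n ^ m
few-ties {n} α β disjoint m R big with ℕₚ.≤-total (sum (χ ∘ β)) (sum (χ ∘ α))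
... | inj₁ M≤P = AntiConcentration.few-ties-ordered α β disjoint M≤P m R big
... | inj₂ P≤M = ℕₚ.≤-trans (ℕₚ.≤-reflexive (cong (R ·_) (∑ʷ-cong m λ f → δ-sym (along (χ ∘ α) f) (along (χ ∘ β) f))))
    (AntiConcentration.few-ties-ordered β α (λ z βz αz → disjoint z αz βz) P≤M m R
      (ℕₚ.≤-trans big (ℕₚ.≤-reflexive (cong (suc m ·_) (ℕₚ.+-comm (sum (χ ∘ α)) (sum (χ ∘ β)))))))
  where
  δ-sym : ∀ a b → δ a b ≡ δ b a
  δ-sym zero    zero    = refl
  δ-sym zero    (suc b) = refl
  δ-sym (suc a) zero    = refl
  δ-sym (suc a) (suc b) = δ-sym a b

-- Resampling random positions of a word

double-sum : ∀ {n} → (Fin n → Fin n → ℕ) → ℕ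
double-sum f = sum λ x → sum (f x)

module _ {n : ℕ} where

  double-sum-mono : {f g : Fin n → Fin n → ℕ} → (∀ x y → f x y ≼ g x y) → double-sum f ≼ double-sum g
  double-sum-mono f≤g = sum-mono λ x → sum-mono (f≤g x)

  double-sum-cong : {f g : Fin n → Fin n → ℕ} → (∀ x y → f x y ≡ g x y) → double-sum f ≡ double-sum g
  double-sum-cong f≡g = sum-cong-≗ λ x → sum-cong-≗ (f≡g x)

  double-sum-+ : (f g : Fin n → Fin n → ℕ) → double-sum (λ x y → f x y + g x y) ≡ double-sum f + double-sum g
  double-sum-+ f g = trans (sum-cong-≗ λ x → sum-+ (f x) (g x)) (sum-+ (λ x → sum (f x)) (λ x → sum (g x)))

  double-sum-*ˡ : ∀ c (f : Fin n → Fin n → ℕ) → double-sum (λ x y → c · f x y) ≡ c · double-sum f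
  double-sum-*ˡ c f = trans (sum-cong-≗ λ x → sum-*ˡ c (f x)) (sum-*ˡ c λ x → sum (f x))

  double-sum-const : ∀ c → double-sum {n} (λ _ _ → c) ≡ n · n · c
  double-sum-const c = trans (sum-cong-≗ {n} λ _ → sum-const n c) (trans (sum-const n _) (sym (ℕₚ.*-assoc n n c)))

  double-sum-sides : (A : Fin n → ℕ) → double-sum (λ x y → A x + A y) ≡ 2 · (n · sum A)
  double-sum-sides A = begin
    double-sum (λ x y → A x + A y)                           ≡⟨ double-sum-+ (λ x _ → A x) (λ _ y → A y) ⟩
    sum (λ x → sum {n} (λ _ → A x)) + sum {n} (λ _ → sum A)  ≡⟨ cong₂ _+_ (trans (sum-cong-≗ λ x → sum-const n (A x)) (sum-*ˡ n A)) (sum-const n (sum A)) ⟩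
    n · sum A + n · sum A                                    ≡⟨ cong (n · sum A +_) (ℕₚ.+-identityʳ _) ⟨
    2 · (n · sum A)                                          ∎
    where open ≡-Reasoning

module Resampling {n : ℕ} (ν : Fin n → Fin n → Bool) where

  g ḡ : ℕ
  g = double-sum λ x y → χ (ν x y)
  ḡ = double-sum λ x y → χ (not (ν x y))

  g+ḡ : g + ḡ ≡ n · n
  g+ḡ = begin
    g + ḡ                                            ≡⟨ double-sum-+ (λ x y → χ (ν x y)) (λ x y → χ (not (ν x y))) ⟨
    double-sum (λ x y → χ (ν x y) + χ (not (ν x y))) ≡⟨ double-sum-cong (λ x y → complement (ν x y)) ⟩
    double-sum {n} (λ _ _ → 1)                       ≡⟨ double-sum-const {n} 1 ⟩
    n · n · 1                                        ≡⟨ ℕₚ.*-identityʳ (n · n) ⟩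
    n · n                                            ∎
    where
    open ≡-Reasoning
    complement : ∀ b → χ b + χ (not b) ≡ 1
    complement true  = refl
    complement false = refl

  -- Over `n ^ (2 + l)` this is the expected exception τ for a random pair, counted only if the pair
  -- is in ν, and a random word in the remaining positions.
  T : ℕ → (Fin n → Fin n → List (Fin n) → ℕ) → ℕ
  T l τ = double-sum λ x y → χ (ν x y) · ∑ʷ l (τ x y)

  T-suc : ∀ l τ → sum (λ z → T l (λ x y f → τ x y (z ∷ f))) ≡ T (suc l) τ
  T-suc l τ = begin
    sum (λ z → sum (λ x → sum (λ y → χ (ν x y) · A x y z)))
      ≡⟨ sum-comm (λ z x → sum (λ y → χ (ν x y) · A x y z)) ⟩
    sum (λ x → sum (λ z → sum (λ y → χ (ν x y) · A x y z)))
      ≡⟨ sum-cong-≗ (λ x → trans (sum-comm (λ z y → χ (ν x y) · A x y z))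
           (sum-cong-≗ λ y → sum-*ˡ (χ (ν x y)) (A x y))) ⟩
    T (suc l) τ ∎
    where
    open ≡-Reasoning
    A : Fin n → Fin n → Fin n → ℕ
    A x y z = ∑ʷ l λ f → τ x y (z ∷ f)

  -- Replace the first s letters by random pairs of letters, from which one letter each is then
  -- chosen at random.  A pair in ν lets at most one of its two choices satisfy φ, up to the
  -- exceptions recorded by τ, and there is such a pair except with probability (ḡ / n²)ˢ.
  resample : ∀ s m (φ : List (Fin n) → ℕ) (τ : Fin n → Fin n → List (Fin n) → ℕ) →
    (∀ f → φ f ≼ 1) →
    (∀ x y p r → ν x y ≡ true → φ (p ++ x ∷ r) · φ (p ++ y ∷ r) ≼ τ x y (p ++ r)) →
    2 · (n · n ^ s) · ∑ʷ (suc (s + m)) φ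
      ≼ (n · n ^ s) · n ^ suc (s + m) + s · n ^ s · T (s + m) τ + 2 · ḡ ^ s · (n · n · n ^ m)
  -- With no position resampled the bound is trivial and is carried by the last summand alone.
  resample zero m φ τ φ≤1 φφ≤τ = begin
    2 · (n · 1) · ∑ʷ (suc m) φ                     ≤⟨ ℕₚ.*-monoʳ-≤ (2 · (n · 1)) (∑ʷ-mono (suc m) φ≤1) ⟩
    2 · (n · 1) · ∑ʷ {n} (suc m) (λ _ → 1)         ≡⟨ cong (2 · (n · 1) ·_) (∑ʷ-const {n} (suc m) 1) ⟩
    2 · (n · 1) · (1 · n ^ suc m)                  ≡⟨ regroup n (n ^ m) ⟩
    2 · 1 · (n · n · n ^ m)                        ≤⟨ ℕₚ.m≤n+m _ ((n · 1) · n ^ suc m + 0) ⟩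
    (n · 1) · n ^ suc m + 0 + 2 · 1 · (n · n · n ^ m) ∎
    where
    open ≤-Reasoning
    regroup : ∀ n p → 2 · (n · 1) · (1 · (n · p)) ≡ 2 · 1 · (n · n · p)
    regroup = solve-∀
  resample (suc s) m φ τ φ≤1 φφ≤τ = ℕₚ.*-cancelˡ-≤ 2 (begin
    2 · (2 · (n · (n · n ^ s)) · sum A)
      ≡⟨ shuffle₁ n (n ^ s) (sum A) ⟩
    2 · (n · n ^ s) · (2 · (n · sum A))
      ≡⟨ cong (2 · (n · n ^ s) ·_) (double-sum-sides A) ⟨
    2 · (n · n ^ s) · double-sum (λ x y → A x + A y)
      ≡⟨ double-sum-*ˡ (2 · (n · n ^ s)) (λ x y → A x + A y) ⟨
    double-sum (λ x y → 2 · (n · n ^ s) · (A x + A y))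
      ≤⟨ double-sum-mono pair ⟩
    double-sum (λ x y → (2 · Q + 2 · (n · n ^ s) · (χ (ν x y) · τ̂ x y)) + (2 · E · χ (not (ν x y)) + s · n ^ s · (S x + S y)))
      ≡⟨ double-sum-+ (λ x y → 2 · Q + 2 · (n · n ^ s) · (χ (ν x y) · τ̂ x y)) (λ x y → 2 · E · χ (not (ν x y)) + s · n ^ s · (S x + S y)) ⟩
    double-sum (λ x y → 2 · Q + 2 · (n · n ^ s) · (χ (ν x y) · τ̂ x y)) + double-sum (λ x y → 2 · E · χ (not (ν x y)) + s · n ^ s · (S x + S y))
      ≡⟨ cong₂ _+_ (double-sum-+ (λ _ _ → 2 · Q) (λ x y → 2 · (n · n ^ s) · (χ (ν x y) · τ̂ x y)))
                   (double-sum-+ (λ x y → 2 · E · χ (not (ν x y))) (λ x y → s · n ^ s · (S x + S y))) ⟩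
    double-sum {n} (λ _ _ → 2 · Q) + double-sum (λ x y → 2 · (n · n ^ s) · (χ (ν x y) · τ̂ x y)) +
      (double-sum (λ x y → 2 · E · χ (not (ν x y))) + double-sum (λ x y → s · n ^ s · (S x + S y)))
      ≡⟨ cong₂ _+_
           (cong₂ _+_ (double-sum-const {n} (2 · Q)) (double-sum-*ˡ (2 · (n · n ^ s)) (λ x y → χ (ν x y) · τ̂ x y)))
           (cong₂ _+_ (double-sum-*ˡ (2 · E) (λ x y → χ (not (ν x y))))
             (trans (double-sum-*ˡ (s · n ^ s) (λ x y → S x + S y))
               (cong (s · n ^ s ·_) (trans (double-sum-sides S) (cong (λ t → 2 · (n · t)) (T-suc l τ)))))) ⟩
    n · n · (2 · Q) + 2 · (n · n ^ s) · T (suc l) τ + (2 · E · ḡ + s · n ^ s · (2 · (n · T (suc l) τ)))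
      ≡⟨ shuffle₂ n (n ^ s) (n ^ l) s (T (suc l) τ) (ḡ ^ s) ḡ (n ^ m) ⟩
    2 · ((n · (n · n ^ s)) · (n · (n · n ^ l)) + suc s · (n · n ^ s) · T (suc l) τ + 2 · (ḡ · ḡ ^ s) · (n · n · n ^ m)) ∎)
    where
    open ≤-Reasoning
    l = s + m
    A S : Fin n → ℕ
    A x = ∑ʷ (suc l) λ f → φ (x ∷ f)
    S z = T l λ x y f → τ x y (z ∷ f)
    τ̂ : Fin n → Fin n → ℕ
    τ̂ x y = ∑ʷ (suc l) (τ x y)
    Q = (n · n ^ s) · n ^ suc l
    E = 2 · ḡ ^ s · (n · n · n ^ m)
    shuffle₁ : ∀ n p a → 2 · (2 · (n · (n · p)) · a) ≡ 2 · (n · p) · (2 · (n · a))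
    shuffle₁ = solve-∀
    shuffle₂ : ∀ n p q s t e ḡ r →
      n · n · (2 · ((n · p) · (n · q))) + 2 · (n · p) · t + (2 · (2 · e · (n · n · r)) · ḡ + s · p · (2 · (n · t)))
      ≡ 2 · ((n · (n · p)) · (n · (n · q)) + suc s · (n · p) · t + 2 · (ḡ · e) · (n · n · r))
    shuffle₂ = solve-∀
    a+b≤1+ab : ∀ {a b} → a ≼ 1 → b ≼ 1 → a + b ≼ 1 + a · b
    a+b≤1+ab {zero}  {b}     _         b≤1 = b≤1
    a+b≤1+ab {suc zero} {b}  _         _   = s≤s (ℕₚ.m≤m+n b 0)
    a+b≤1+ab {suc (suc a)}   (s≤s ())  _
    A-sum : ∀ x y → ν x y ≡ true → A x + A y ≼ n ^ suc l + τ̂ x y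
    A-sum x y νxy = begin
      A x + A y                                    ≡⟨ ∑ʷ-+ (suc l) (λ f → φ (x ∷ f)) (λ f → φ (y ∷ f)) ⟨
      ∑ʷ (suc l) (λ f → φ (x ∷ f) + φ (y ∷ f))     ≤⟨ ∑ʷ-mono (suc l) (λ f → ℕₚ.≤-trans (a+b≤1+ab (φ≤1 (x ∷ f)) (φ≤1 (y ∷ f))) (ℕₚ.+-monoʳ-≤ 1 (φφ≤τ x y [] f νxy))) ⟩
      ∑ʷ (suc l) (λ f → 1 + τ x y f)               ≡⟨ ∑ʷ-+ (suc l) (λ _ → 1) (τ x y) ⟩
      ∑ʷ {n} (suc l) (λ _ → 1) + τ̂ x y             ≡⟨ cong (_+ τ̂ x y) (trans (∑ʷ-const {n} (suc l) 1) (ℕₚ.*-identityˡ (n ^ suc l))) ⟩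
      n ^ suc l + τ̂ x y                            ∎
    rec : ∀ z → 2 · (n · n ^ s) · A z ≼ Q + s · n ^ s · S z + E
    rec z = resample s m (λ f → φ (z ∷ f)) (λ x y f → τ x y (z ∷ f)) (λ f → φ≤1 (z ∷ f)) (λ x y p r → φφ≤τ x y (z ∷ p) r)
    -- A pair in ν settles the matter at this position, and the later letters are left free.
    -- Otherwise each candidate in turn is kept as the head, and the next position is resampled.
    pair : ∀ x y → 2 · (n · n ^ s) · (A x + A y)
      ≼ (2 · Q + 2 · (n · n ^ s) · (χ (ν x y) · τ̂ x y)) + (2 · E · χ (not (ν x y)) + s · n ^ s · (S x + S y))
    pair x y with ν x y in νxy
    ... | true = begin
      2 · (n · n ^ s) · (A x + A y)              ≤⟨ ℕₚ.*-monoʳ-≤ (2 · (n · n ^ s)) (A-sum x y νxy) ⟩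
      2 · (n · n ^ s) · (n ^ suc l + τ̂ x y)      ≡⟨ regroup (n · n ^ s) (n ^ suc l) (τ̂ x y) ⟩
      2 · Q + 2 · (n · n ^ s) · (1 · τ̂ x y)      ≤⟨ ℕₚ.m≤m+n _ _ ⟩
      (2 · Q + 2 · (n · n ^ s) · (1 · τ̂ x y)) + (2 · E · 0 + s · n ^ s · (S x + S y)) ∎
      where
      regroup : ∀ p q t → 2 · p · (q + t) ≡ 2 · (p · q) + 2 · p · (1 · t)
      regroup = solve-∀
    ... | false = begin
      2 · (n · n ^ s) · (A x + A y)                                    ≡⟨ ℕₚ.*-distribˡ-+ (2 · (n · n ^ s)) (A x) (A y) ⟩
      2 · (n · n ^ s) · A x + 2 · (n · n ^ s) · A y                    ≤⟨ ℕₚ.+-mono-≤ (rec x) (rec y) ⟩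
      (Q + s · n ^ s · S x + E) + (Q + s · n ^ s · S y + E)            ≡⟨ regroup Q (s · n ^ s) (S x) (S y) E (n · n ^ s) (τ̂ x y) ⟩
      (2 · Q + 2 · (n · n ^ s) · (0 · τ̂ x y)) + (2 · E · 1 + s · n ^ s · (S x + S y)) ∎
      where
      regroup : ∀ Q c a b e p t → (Q + c · a + e) + (Q + c · b + e) ≡ (2 · Q + 2 · p · (0 · t)) + (2 · e · 1 + c · (a + b))
      regroup = solve-∀

  -- For the density `p = g / n²` this is `(1 - p)ˢ ≤ 1 / (1 + s p)`, which follows inductively from
  -- `(1 - p)(1 + (s + 1) p) ≤ 1 + s p`.
  bernoulli : ∀ s → ḡ ^ s · (n · n + s · g) ≼ (n · n) · (n · n) ^ s
  bernoulli zero    = ℕₚ.≤-reflexive (regroup (n · n))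
    where
    regroup : ∀ a → 1 · (a + 0) ≡ a · 1
    regroup = solve-∀
  bernoulli (suc s) = begin
    ḡ · ḡ ^ s · (n · n + suc s · g)          ≤⟨ ℕₚ.m≤m+n _ (ḡ ^ s · (g · g + s · (g · g))) ⟩
    ḡ · ḡ ^ s · (n · n + suc s · g) + ḡ ^ s · (g · g + s · (g · g))
                                             ≡⟨ cong (λ t → ḡ · ḡ ^ s · (t + suc s · g) + ḡ ^ s · (g · g + s · (g · g))) g+ḡ ⟨
    ḡ · ḡ ^ s · (g + ḡ + suc s · g) + ḡ ^ s · (g · g + s · (g · g))
                                             ≡⟨ regroup g ḡ (ḡ ^ s) s ⟩
    (g + ḡ) · (ḡ ^ s · (g + ḡ + s · g))      ≡⟨ cong (λ t → t · (ḡ ^ s · (t + s · g))) g+ḡ ⟩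
    n · n · (ḡ ^ s · (n · n + s · g))        ≤⟨ ℕₚ.*-monoʳ-≤ (n · n) (bernoulli s) ⟩
    n · n · (n · n · (n · n) ^ s)            ∎
    where
    open ≤-Reasoning
    regroup : ∀ g h e s → h · e · (g + h + suc s · g) + e · (g · g + s · (g · g)) ≡ (g + h) · (e · (g + h + s · g))
    regroup = solve-∀

  -- The least `s` with `B ≤ s · g` overshoots by at most `g`. The lower bound makes a pair in ν
  -- likely to appear, the upper bound keeps the total loss from ties small.
  choose : ∀ l B → B ≼ l · g → ∃[ s ] (s ≼ l × B ≼ s · g × s · g ≼ B + g)
  choose zero    B B≤ = 0 , z≤n , B≤ , z≤n
  choose (suc l) B B≤ with B ℕ.≤? l · g
  ... | yes B≤lg = let s , s≤l , rest = choose l B B≤lg in s , ℕₚ.m≤n⇒m≤1+n s≤l , rest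
  ... | no  B≰lg = suc l , ℕₚ.≤-refl , B≤ ,
    ℕₚ.≤-trans (ℕₚ.≤-reflexive (ℕₚ.+-comm g (l · g))) (ℕₚ.+-monoˡ-≤ g (ℕₚ.<⇒≤ (ℕₚ.≰⇒> B≰lg)))

  -- In units of `n ^ suc l`, the three terms of `resample` contribute `suc L` for the one good
  -- choice in each pair, 1 for ties and 2 for the absence of a pair in ν. The last two use
  -- `R = 3 (1 + L)²` and `bernoulli`.
  many-pairs : ∀ l L (φ : List (Fin n) → ℕ) (τ : Fin n → Fin n → List (Fin n) → ℕ) .{{_ : ℕ.NonZero n}} →
    let R = 3 · (suc L · suc L) in
    (∀ f → φ f ≼ 1) →
    (∀ x y p r → ν x y ≡ true → φ (p ++ x ∷ r) · φ (p ++ y ∷ r) ≼ τ x y (p ++ r)) →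
    (∀ x y → ν x y ≡ true → R · ∑ʷ l (τ x y) ≼ 3 · n ^ l) →
    L · (n · n) ≼ l · g →
    2 · suc L · ∑ʷ (suc l) φ ≼ (4 + L) · n ^ suc l
  many-pairs l L φ τ φ≤1 φφ≤τ τ-rare enough with choose l (L · (n · n)) enough
  ... | s , s≤l , Ln²≤sg , sg≤ with l ∸ s | ℕₚ.m+[n∸m]≡n s≤l
  ...   | m | refl = ℕₚ.*-cancelˡ-≤ (n · n ^ s) (begin
    n · p · (2 · suc L · Φ)                                     ≡⟨ shuffle₁ n p L Φ ⟩
    suc L · (2 · (n · p) · Φ)                                   ≤⟨ ℕₚ.*-monoʳ-≤ (suc L) (resample s m φ τ φ≤1 φφ≤τ) ⟩
    suc L · ((n · p) · (n · q) + s · p · T (s + m) τ + 2 · ḡ ^ s · (n · n · n ^ m))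
                                                                ≡⟨ shuffle₂ n p (n · q) L s (T (s + m) τ) (ḡ ^ s) (n ^ m) ⟩
    suc L · ((n · p) · (n · q)) + p · (suc L · (s · T (s + m) τ)) + 2 · (n · n · n ^ m) · (suc L · ḡ ^ s)
                                                                ≤⟨ ℕₚ.+-mono-≤ (ℕₚ.+-monoʳ-≤ (suc L · ((n · p) · (n · q))) (ℕₚ.*-monoʳ-≤ p ties-small)) (ℕₚ.*-monoʳ-≤ (2 · (n · n · n ^ m)) ḡ-small) ⟩
    suc L · ((n · p) · (n · q)) + p · (n · n · q) + 2 · (n · n · n ^ m) · (p · p)
                                                                ≡⟨ cong (λ t → suc L · ((n · p) · (n · t)) + p · (n · n · t) + 2 · (n · n · n ^ m) · (p · p)) q≡ ⟩
    suc L · ((n · p) · (n · (p · n ^ m))) + p · (n · n · (p · n ^ m)) + 2 · (n · n · n ^ m) · (p · p)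
                                                                ≡⟨ shuffle₃ n p (n ^ m) L ⟩
    n · p · ((4 + L) · (n · (p · n ^ m)))                       ≡⟨ cong (λ t → n · p · ((4 + L) · (n · t))) q≡ ⟨
    n · p · ((4 + L) · (n · q))                                 ∎)
    where
    open ≤-Reasoning
    instance
      _ : ℕ.NonZero (n ^ s)
      _ = ℕₚ.m^n≢0 n s
      _ : ℕ.NonZero (n · n ^ s)
      _ = ℕₚ.m*n≢0 n (n ^ s)
      _ : ℕ.NonZero (n · n)
      _ = ℕₚ.m*n≢0 n n
    R = 3 · (suc L · suc L)
    p = n ^ s
    q = n ^ (s + m)
    Φ = ∑ʷ (suc (s + m)) φ
    q≡ : q ≡ p · n ^ m
    q≡ = ℕₚ.^-distribˡ-+-* n s m
    shuffle₁ : ∀ n p L Φ → n · p · (2 · suc L · Φ) ≡ suc L · (2 · (n · p) · Φ)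
    shuffle₁ = solve-∀
    shuffle₂ : ∀ n p q L s t e r → suc L · ((n · p) · q + s · p · t + 2 · e · (n · n · r))
      ≡ suc L · ((n · p) · q) + p · (suc L · (s · t)) + 2 · (n · n · r) · (suc L · e)
    shuffle₂ = solve-∀
    shuffle₃ : ∀ n p r L → suc L · ((n · p) · (n · (p · r))) + p · (n · n · (p · r)) + 2 · (n · n · r) · (p · p)
      ≡ n · p · ((4 + L) · (n · (p · r)))
    shuffle₃ = solve-∀
    ḡ-small : suc L · ḡ ^ s ≼ p · p
    ḡ-small = ℕₚ.*-cancelˡ-≤ (n · n) (begin
      n · n · (suc L · ḡ ^ s)          ≡⟨ regroup (n · n) L (ḡ ^ s) ⟩
      ḡ ^ s · (n · n + L · (n · n))    ≤⟨ ℕₚ.*-monoʳ-≤ (ḡ ^ s) (ℕₚ.+-monoʳ-≤ (n · n) Ln²≤sg) ⟩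
      ḡ ^ s · (n · n + s · g)          ≤⟨ bernoulli s ⟩
      n · n · (n · n) ^ s              ≡⟨ cong (n · n ·_) (^-distribʳ-* s) ⟩
      n · n · (p · p)                  ∎)
      where
      regroup : ∀ a L e → a · (suc L · e) ≡ e · (a + L · a)
      regroup = solve-∀
      ^-distribʳ-* : ∀ s → (n · n) ^ s ≡ n ^ s · n ^ s
      ^-distribʳ-* zero    = refl
      ^-distribʳ-* (suc s) = trans (cong (n · n ·_) (^-distribʳ-* s)) (interchange n n (n ^ s) (n ^ s))
        where
        interchange : ∀ a b c d → (a · b) · (c · d) ≡ (a · c) · (b · d)
        interchange = solve-∀
    T-small : R · T (s + m) τ ≼ g · (3 · q)
    T-small = begin
      R · T (s + m) τ                                                      ≡⟨ double-sum-*ˡ R (λ x y → χ (ν x y) · ∑ʷ (s + m) (τ x y)) ⟨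
      double-sum (λ x y → R · (χ (ν x y) · ∑ʷ (s + m) (τ x y)))            ≤⟨ double-sum-mono term ⟩
      double-sum (λ x y → 3 · q · χ (ν x y))                               ≡⟨ double-sum-*ˡ (3 · q) (λ x y → χ (ν x y)) ⟩
      3 · q · g                                                            ≡⟨ ℕₚ.*-comm (3 · q) g ⟩
      g · (3 · q)                                                          ∎
      where
      term : ∀ x y → R · (χ (ν x y) · ∑ʷ (s + m) (τ x y)) ≼ 3 · q · χ (ν x y)
      term x y with ν x y in νxy
      ... | false = ℕₚ.≤-trans (ℕₚ.≤-reflexive (ℕₚ.*-zeroʳ R)) z≤n
      ... | true  = ℕₚ.≤-trans (ℕₚ.≤-reflexive (cong (R ·_) (ℕₚ.+-identityʳ (∑ʷ (s + m) (τ x y)))))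
                      (ℕₚ.≤-trans (τ-rare x y νxy) (ℕₚ.≤-reflexive (sym (ℕₚ.*-identityʳ (3 · q)))))
    ties-small : suc L · (s · T (s + m) τ) ≼ n · n · q
    ties-small = ℕₚ.*-cancelˡ-≤ R (begin
      R · (suc L · (s · T (s + m) τ))          ≡⟨ regroup₁ R (suc L) s (T (s + m) τ) ⟩
      suc L · s · (R · T (s + m) τ)            ≤⟨ ℕₚ.*-monoʳ-≤ (suc L · s) T-small ⟩
      suc L · s · (g · (3 · q))                ≡⟨ regroup₂ (suc L) s g q ⟩
      suc L · (3 · q) · (s · g)                ≤⟨ ℕₚ.*-monoʳ-≤ (suc L · (3 · q)) (ℕₚ.≤-trans sg≤ (ℕₚ.+-monoʳ-≤ (L · (n · n)) g≤n²)) ⟩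
      suc L · (3 · q) · (L · (n · n) + n · n)  ≡⟨ regroup₃ L q (n · n) ⟩
      R · (n · n · q)                          ∎)
      where
      g≤n² : g ≼ n · n
      g≤n² = ℕₚ.≤-trans (ℕₚ.m≤m+n g ḡ) (ℕₚ.≤-reflexive g+ḡ)
      regroup₁ : ∀ r l s t → r · (l · (s · t)) ≡ l · s · (r · t)
      regroup₁ = solve-∀
      regroup₂ : ∀ l s g q → l · s · (g · (3 · q)) ≡ l · (3 · q) · (s · g)
      regroup₂ = solve-∀
      regroup₃ : ∀ L q a → suc L · (3 · q) · (L · a + a) ≡ 3 · (suc L · suc L) · (a · q)
      regroup₃ = solve-∀

-- Edges spanned by a random word

module Graph {n : ℕ} (adj : Fin n → Fin n → Bool)
  (symmetric : ∀ x y → adj x y ≡ adj y x) (irreflexive : ∀ x → adj x x ≡ false) where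

  deg codeg : Fin n → List (Fin n) → ℕ
  deg   z = along λ w → χ (adj z w)
  codeg z = along λ w → χ (not (adj z w))

  -- Ordered pairs of positions: an edge counts twice in `X₂`. Equal letters, and so each position
  -- paired with itself, count in `Y₂`, which makes the two add up to the square of the length.
  X₂ Y₂ : List (Fin n) → ℕ
  X₂ f = along (λ z → deg z f) f
  Y₂ f = along (λ z → codeg z f) f

  X₂-insert : ∀ p x r → X₂ (p ++ x ∷ r) ≡ 2 · deg x (p ++ r) + X₂ (p ++ r)
  X₂-insert p x r = begin
    X₂ (p ++ x ∷ r)
      ≡⟨ along-insert (λ z → deg z (p ++ x ∷ r)) p ⟩
    deg x (p ++ x ∷ r) + along (λ z → deg z (p ++ x ∷ r)) (p ++ r)
      ≡⟨ cong₂ _+_ (along-insert (λ w → χ (adj x w)) p) (along-cong (λ z → along-insert (λ w → χ (adj z w)) p) (p ++ r)) ⟩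
    χ (adj x x) + deg x (p ++ r) + along (λ z → χ (adj z x) + deg z (p ++ r)) (p ++ r)
      ≡⟨ cong₂ _+_ (cong (λ b → χ b + deg x (p ++ r)) (irreflexive x)) (along-+ (λ z → χ (adj z x)) _ (p ++ r)) ⟩
    deg x (p ++ r) + (along (λ z → χ (adj z x)) (p ++ r) + X₂ (p ++ r))
      ≡⟨ cong (λ t → deg x (p ++ r) + (t + X₂ (p ++ r))) (along-cong (λ z → cong χ (symmetric z x)) (p ++ r)) ⟩
    deg x (p ++ r) + (deg x (p ++ r) + X₂ (p ++ r))
      ≡⟨ regroup (deg x (p ++ r)) _ ⟩
    2 · deg x (p ++ r) + X₂ (p ++ r) ∎
    where
    open ≡-Reasoning
    regroup : ∀ a b → a + (a + b) ≡ 2 · a + b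
    regroup = solve-∀

  module _ (x y : Fin n) where
    only₁ only₂ : Fin n → Bool
    only₁ z = adj x z ∧ not (adj y z)
    only₂ z = not (adj x z) ∧ adj y z

    only-disjoint : ∀ z → only₁ z ≡ true → only₂ z ≡ true → ⊥
    only-disjoint z _ _ with adj x z
    only-disjoint z () _  | false
    only-disjoint z _  () | true

  tie : Fin n → Fin n → List (Fin n) → ℕ
  tie x y f = δ (along (χ ∘ only₁ x y) f) (along (χ ∘ only₂ x y) f)

  distance : Fin n → Fin n → ℕ
  distance x y = sum (χ ∘ only₁ x y) + sum (χ ∘ only₂ x y)

  distance≤n : ∀ x y → distance x y ≼ n
  distance≤n x y = begin
    distance x y                                              ≡⟨ sum-+ (χ ∘ only₁ x y) (χ ∘ only₂ x y) ⟨
    sum (λ z → χ (only₁ x y z) + χ (only₂ x y z))             ≤⟨ sum-mono (λ z → exclusive (adj x z) (adj y z)) ⟩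
    sum {n} (λ _ → 1)                                         ≡⟨ trans (sum-const n 1) (ℕₚ.*-identityʳ n) ⟩
    n                                                         ∎
    where
    open ≤-Reasoning
    exclusive : ∀ a b → χ (a ∧ not b) + χ (not a ∧ b) ≼ 1
    exclusive true  true  = z≤n
    exclusive true  false = ℕₚ.≤-refl
    exclusive false true  = ℕₚ.≤-refl
    exclusive false false = z≤n

  -- Exchanging `x` for `y` changes `X₂` by twice the difference of their degrees into the rest of
  -- the word. If the value is the same, the degrees agree, and the common neighbours cancel.
  both⇒tie : ∀ t x y p r → δ (X₂ (p ++ x ∷ r)) t · δ (X₂ (p ++ y ∷ r)) t ≼ tie x y (p ++ r)
  both⇒tie t x y p r with X₂ (p ++ x ∷ r) ℕ.≟ t | X₂ (p ++ y ∷ r) ℕ.≟ t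
  ... | no  ≢t | _      rewrite δ-≢ ≢t = z≤n
  ... | yes _  | no  ≢t rewrite δ-≢ ≢t = ℕₚ.≤-trans (ℕₚ.≤-reflexive (ℕₚ.*-zeroʳ (δ (X₂ (p ++ x ∷ r)) t))) z≤n
  ... | yes x≡ | yes y≡ = ℕₚ.≤-trans (ℕₚ.*-mono-≤ (χ≤1 (X₂ (p ++ x ∷ r) ℕ.≡ᵇ t)) (χ≤1 (X₂ (p ++ y ∷ r) ℕ.≡ᵇ t)))
      (ℕₚ.≤-reflexive (sym tied))
    where
    q = p ++ r
    deg≡ : deg x q ≡ deg y q
    deg≡ = ℕₚ.*-cancelˡ-≡ (deg x q) (deg y q) 2 (ℕₚ.+-cancelʳ-≡ (X₂ q) _ _
      (trans (sym (X₂-insert p x r)) (trans (trans x≡ (sym y≡)) (X₂-insert p y r))))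
    both : Fin n → ℕ
    both z = χ (adj x z ∧ adj y z)
    deg-x : along (χ ∘ only₁ x y) q + along both q ≡ deg x q
    deg-x = trans (sym (along-+ (χ ∘ only₁ x y) both q)) (along-cong (λ z → split (adj x z) (adj y z)) q)
      where
      split : ∀ a b → χ (a ∧ not b) + χ (a ∧ b) ≡ χ a
      split true  true  = refl
      split true  false = refl
      split false _     = refl
    deg-y : along (χ ∘ only₂ x y) q + along both q ≡ deg y q
    deg-y = trans (sym (along-+ (χ ∘ only₂ x y) both q)) (along-cong (λ z → split (adj x z) (adj y z)) q)
      where
      split : ∀ a b → χ (not a ∧ b) + χ (a ∧ b) ≡ χ b
      split true  _     = refl
      split false true  = refl
      split false false = refl
    tied : tie x y q ≡ 1
    tied rewrite ℕₚ.+-cancelʳ-≡ (along both q) _ _ (trans deg-x (trans deg≡ (sym deg-y)))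
      = δ-refl (along (χ ∘ only₂ x y) q)

  X₂+Y₂ : ∀ f → X₂ f + Y₂ f ≡ length f · length f
  X₂+Y₂ f = begin
    X₂ f + Y₂ f                             ≡⟨ along-+ (λ z → deg z f) (λ z → codeg z f) f ⟨
    along (λ z → deg z f + codeg z f) f     ≡⟨ along-cong (λ z → deg+codeg z f) f ⟩
    along (λ z → length f) f                ≡⟨ along-const (length f) f ⟩
    length f · length f                     ∎
    where
    open ≡-Reasoning
    complement : ∀ b → χ b + χ (not b) ≡ 1
    complement true  = refl
    complement false = refl
    deg+codeg : ∀ z f → deg z f + codeg z f ≡ length f
    deg+codeg z f = trans (sym (along-+ (λ w → χ (adj z w)) _ f))
      (trans (along-cong (λ w → complement (adj z w)) f) (trans (along-const 1 f) (ℕₚ.*-identityʳ (length f))))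

  -- Cherries consisting of an edge and a non-edge.
  mixed : List (Fin n) → ℕ
  mixed f = along (λ z → deg z f · codeg z f) f

  -- Given an edge ab and a non-edge cd, either the pair ab, bc or the pair bc, cd is mixed.
  X₂·Y₂≤ : ∀ f → X₂ f · Y₂ f ≼ 2 · (length f · mixed f)
  X₂·Y₂≤ f = begin
    X₂ f · Y₂ f
      ≡⟨ along-*ʳ (λ b → deg b f) (Y₂ f) f ⟨
    along (λ b → deg b f · Y₂ f) f
      ≡⟨ along-cong (λ b → along-*ˡ (deg b f) (λ c → codeg c f) f) f ⟨
    along (λ b → along (λ c → deg b f · codeg c f) f) f
      ≤⟨ along-mono (λ b → along-mono (λ c → pair b c) f) f ⟩
    along (λ b → along (λ c → k · deg b f · χ (not (adj b c)) + k · codeg c f · χ (adj c b)) f) f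
      ≡⟨ along-cong (λ b → along-+ (λ c → k · deg b f · χ (not (adj b c))) _ f) f ⟩
    along (λ b → along (λ c → k · deg b f · χ (not (adj b c))) f + along (λ c → k · codeg c f · χ (adj c b)) f) f
      ≡⟨ along-+ (λ b → along (λ c → k · deg b f · χ (not (adj b c))) f) _ f ⟩
    along (λ b → along (λ c → k · deg b f · χ (not (adj b c))) f) f + along (λ b → along (λ c → k · codeg c f · χ (adj c b)) f) f
      ≡⟨ cong₂ _+_
           (along-cong (λ b → trans (along-*ˡ (k · deg b f) (λ c → χ (not (adj b c))) f) (ℕₚ.*-assoc k (deg b f) (codeg b f))) f)
           (trans (along-comm (λ b c → k · codeg c f · χ (adj c b)) f f)
             (along-cong (λ c → trans (along-*ˡ (k · codeg c f) (λ b → χ (adj c b)) f) (regroup k (codeg c f) (deg c f))) f)) ⟩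
    along (λ b → k · (deg b f · codeg b f)) f + along (λ b → k · (deg b f · codeg b f)) f
      ≡⟨ cong (λ t → t + t) (along-*ˡ k (λ b → deg b f · codeg b f) f) ⟩
    k · mixed f + k · mixed f
      ≡⟨ cong (k · mixed f +_) (ℕₚ.+-identityʳ (k · mixed f)) ⟨
    2 · (k · mixed f) ∎
    where
    open ≤-Reasoning
    k = length f
    regroup : ∀ a b c → a · b · c ≡ a · (c · b)
    regroup = solve-∀
    along-χ≤ : (γ : Fin n → Bool) → along (χ ∘ γ) f ≼ k
    along-χ≤ γ = ℕₚ.≤-trans (along-mono (λ z → χ≤1 (γ z)) f)
      (ℕₚ.≤-reflexive (trans (along-const 1 f) (ℕₚ.*-identityʳ k)))
    pair : ∀ b c → deg b f · codeg c f ≼ k · deg b f · χ (not (adj b c)) + k · codeg c f · χ (adj c b)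
    pair b c rewrite symmetric c b with adj b c
    ... | true  = begin
      deg b f · codeg c f                        ≤⟨ ℕₚ.*-monoˡ-≤ (codeg c f) (along-χ≤ (adj b)) ⟩
      k · codeg c f                              ≡⟨ ℕₚ.*-identityʳ _ ⟨
      k · codeg c f · 1                          ≤⟨ ℕₚ.m≤n+m _ (k · deg b f · 0) ⟩
      k · deg b f · 0 + k · codeg c f · 1        ∎
    ... | false = begin
      deg b f · codeg c f                        ≤⟨ ℕₚ.*-monoʳ-≤ (deg b f) (along-χ≤ (λ w → not (adj c w))) ⟩
      deg b f · k                                ≡⟨ trans (ℕₚ.*-comm (deg b f) k) (sym (ℕₚ.*-identityʳ _)) ⟩
      k · deg b f · 1                            ≤⟨ ℕₚ.m≤m+n _ (k · codeg c f · 0) ⟩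
      k · deg b f · 1 + k · codeg c f · 0        ∎

  -- The expected number of mixed cherries

  D D̄ : Fin n → ℕ
  D z = sum λ w → χ (adj z w)
  D̄ z = sum λ w → χ (not (adj z w))

  ∑ʷ-along : ∀ m (h : Fin n → ℕ) → n · ∑ʷ m (along h) ≡ m · sum h · n ^ m
  ∑ʷ-along zero    h = ℕₚ.*-zeroʳ n
  ∑ʷ-along (suc m) h = begin
    n · ∑ʷ (suc m) (along h)                              ≡⟨ cong (n ·_) (∑ʷ-pick m (λ z _ → h z) (λ z _ → h z) λ _ _ _ → refl) ⟩
    n · (suc m · sum (λ z → ∑ʷ {n} m (λ _ → h z)))        ≡⟨ cong (λ t → n · (suc m · t)) (trans (sum-cong-≗ λ z → trans (∑ʷ-const {n} m (h z)) (ℕₚ.*-comm (h z) (n ^ m))) (sum-*ˡ (n ^ m) h)) ⟩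
    n · (suc m · (n ^ m · sum h))                         ≡⟨ regroup n (suc m) (n ^ m) (sum h) ⟩
    suc m · sum h · (n · n ^ m)                           ∎
    where
    open ≡-Reasoning
    regroup : ∀ n m p s → n · (m · (p · s)) ≡ m · s · (n · p)
    regroup = solve-∀

  D≤n : ∀ z → D z ≼ n
  D≤n z = ℕₚ.≤-trans (sum-mono λ w → χ≤1 (adj z w)) (ℕₚ.≤-reflexive (trans (sum-const n 1) (ℕₚ.*-identityʳ n)))

  -- Marking the neighbour of `z` first leaves a shorter random word for the non-neighbour, since a
  -- neighbour does not contribute to `codeg`. The summand `n · n` pays for the `1` in
  -- `suc (codeg z f)`, by `D z ≤ n`.
  ∑ʷ-cherries : ∀ l z → n · n · ∑ʷ l (λ f → deg z f · suc (codeg z f)) ≼ l · n ^ l · (n · n + l · (D z · D̄ z))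
  ∑ʷ-cherries zero    z = ℕₚ.≤-trans (ℕₚ.≤-reflexive (ℕₚ.*-zeroʳ (n · n))) z≤n
  ∑ʷ-cherries (suc m) z = begin
    n · n · ∑ʷ (suc m) (λ f → deg z f · suc (codeg z f))
      ≡⟨ cong (n · n ·_) (∑ʷ-cong (suc m) λ f → sym (along-*ʳ (λ w → χ (adj z w)) (suc (codeg z f)) f)) ⟩
    n · n · ∑ʷ (suc m) (λ f → along (λ w → χ (adj z w) · suc (codeg z f)) f)
      ≡⟨ cong (n · n ·_) (∑ʷ-pick m (λ w f → χ (adj z w) · suc (codeg z f)) (λ w f → χ (adj z w) · suc (codeg z f)) insert) ⟩
    n · n · (suc m · sum (λ w → ∑ʷ m (λ f → χ (adj z w) · suc (codeg z f))))
      ≡⟨ cong (λ t → n · n · (suc m · t)) (trans (sum-cong-≗ λ w → trans (∑ʷ-*ˡ m (χ (adj z w)) S) (ℕₚ.*-comm (χ (adj z w)) _)) (sum-*ˡ (∑ʷ m S) λ w → χ (adj z w))) ⟩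
    n · n · (suc m · (∑ʷ m S · D z))
      ≡⟨ shuffle₁ n m (∑ʷ m S) (D z) ⟩
    suc m · D z · n · (n · ∑ʷ m S)
      ≡⟨ cong (λ t → suc m · D z · n · (n · t)) (∑ʷ-+ m (λ _ → 1) (codeg z)) ⟩
    suc m · D z · n · (n · (∑ʷ {n} m (λ _ → 1) + ∑ʷ m (codeg z)))
      ≡⟨ cong (λ t → suc m · D z · n · t) (trans (ℕₚ.*-distribˡ-+ n (∑ʷ {n} m (λ _ → 1)) _)
           (cong₂ _+_ (cong (n ·_) (∑ʷ-const {n} m 1)) (∑ʷ-along m (λ w → χ (not (adj z w)))))) ⟩
    suc m · D z · n · (n · (1 · n ^ m) + m · D̄ z · n ^ m)
      ≡⟨ shuffle₂ m (D z) n (n ^ m) (D̄ z) ⟩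
    suc m · (n · n ^ m) · (D z · n + m · (D z · D̄ z))
      ≤⟨ ℕₚ.*-monoʳ-≤ (suc m · (n · n ^ m)) (ℕₚ.+-mono-≤ (ℕₚ.*-monoˡ-≤ n (D≤n z)) (ℕₚ.*-monoˡ-≤ (D z · D̄ z) (ℕₚ.n≤1+n m))) ⟩
    suc m · (n · n ^ m) · (n · n + suc m · (D z · D̄ z)) ∎
    where
    open ≤-Reasoning
    S : List (Fin n) → ℕ
    S f = suc (codeg z f)
    insert : ∀ p w r → χ (adj z w) · S (p ++ w ∷ r) ≡ χ (adj z w) · S (p ++ r)
    insert p w r rewrite along-insert (λ w → χ (not (adj z w))) p {w} {r} with adj z w
    ... | true  = refl
    ... | false = refl
    shuffle₁ : ∀ n m s d → n · n · (suc m · (s · d)) ≡ suc m · d · n · (n · s)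
    shuffle₁ = solve-∀
    shuffle₂ : ∀ m d n p e → suc m · d · n · (n · (1 · p) + m · e · p) ≡ suc m · (n · p) · (d · n + m · (d · e))
    shuffle₂ = solve-∀

  ∑ʷ-mixed : ∀ l c .{{_ : ℕ.NonZero n}} → suc l · sum (λ z → D z · D̄ z) ≼ c · (n · n · n) →
             ∑ʷ (suc l) mixed ≼ suc l · suc l · (suc c · n ^ suc l)
  ∑ʷ-mixed l c few = ℕₚ.*-cancelˡ-≤ (n · n) (begin
    n · n · ∑ʷ (suc l) mixed
      ≡⟨ cong (n · n ·_) (∑ʷ-pick l (λ z f → deg z f · codeg z f) (λ z f → deg z f · suc (codeg z f)) insert) ⟩
    n · n · (suc l · sum (λ z → ∑ʷ l (λ f → deg z f · suc (codeg z f))))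
      ≡⟨ trans (shuffle₁ (n · n) (suc l) _) (cong (suc l ·_) (sym (sum-*ˡ (n · n) λ z → ∑ʷ l (λ f → deg z f · suc (codeg z f))))) ⟩
    suc l · sum (λ z → n · n · ∑ʷ l (λ f → deg z f · suc (codeg z f)))
      ≤⟨ ℕₚ.*-monoʳ-≤ (suc l) (sum-mono (∑ʷ-cherries l)) ⟩
    suc l · sum (λ z → l · n ^ l · (n · n + l · (D z · D̄ z)))
      ≡⟨ cong (suc l ·_) (trans (sum-*ˡ (l · n ^ l) (λ z → n · n + l · (D z · D̄ z)))
           (cong (l · n ^ l ·_) (trans (sum-+ (λ _ → n · n) (λ z → l · (D z · D̄ z)))
             (cong₂ _+_ (sum-const n (n · n)) (sum-*ˡ l (λ z → D z · D̄ z)))))) ⟩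
    suc l · (l · n ^ l · (n · (n · n) + l · sum (λ z → D z · D̄ z)))
      ≤⟨ ℕₚ.*-monoʳ-≤ (suc l) (ℕₚ.*-mono-≤ (ℕₚ.*-monoˡ-≤ (n ^ l) (ℕₚ.n≤1+n l))
           (ℕₚ.+-monoʳ-≤ (n · (n · n)) (ℕₚ.≤-trans (ℕₚ.*-monoˡ-≤ _ (ℕₚ.n≤1+n l)) few))) ⟩
    suc l · (suc l · n ^ l · (n · (n · n) + c · (n · n · n)))
      ≡⟨ shuffle₂ (suc l) (n ^ l) n c ⟩
    n · n · (suc l · suc l · (suc c · (n · n ^ l))) ∎)
    where
    open ≤-Reasoning
    instance
      _ : ℕ.NonZero (n · n)
      _ = ℕₚ.m*n≢0 n n
    -- The `suc` is the centre's own position: `z` is not adjacent to itself. These degenerate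
    -- cherries account for the `1` in `suc c`.
    insert : ∀ p z r → deg z (p ++ z ∷ r) · codeg z (p ++ z ∷ r) ≡ deg z (p ++ r) · suc (codeg z (p ++ r))
    insert p z r rewrite along-insert (λ w → χ (adj z w)) p {z} {r} | along-insert (λ w → χ (not (adj z w))) p {z} {r} | irreflexive z = refl
    shuffle₁ : ∀ a b c → a · (b · c) ≡ b · (a · c)
    shuffle₁ = solve-∀
    shuffle₂ : ∀ l p n c → l · (l · p · (n · (n · n) + c · (n · n · n))) ≡ n · n · (l · l · (suc c · (n · p)))
    shuffle₂ = solve-∀

  -- Both sides concern triples of a vertex `z`, a neighbour `x` and a non-neighbour `y`: for fixed
  -- `x` and `y`, such `z` are the elements of `only₁ x y`.
  ∑-distance : sum (λ z → D z · D̄ z) ≼ double-sum distance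
  ∑-distance = begin
    sum (λ z → D z · D̄ z)
      ≡⟨ sum-cong-≗ (λ z → trans (ℕₚ.*-comm (D z) (D̄ z)) (trans (sym (sum-*ˡ (D̄ z) λ x → χ (adj z x)))
           (sum-cong-≗ λ x → trans (ℕₚ.*-comm (D̄ z) (χ (adj z x))) (sym (sum-*ˡ (χ (adj z x)) λ y → χ (not (adj z y))))))) ⟩
    sum (λ z → sum (λ x → sum (λ y → χ (adj z x) · χ (not (adj z y)))))
      ≡⟨ trans (sum-comm λ z x → sum (λ y → χ (adj z x) · χ (not (adj z y))))
           (sum-cong-≗ λ x → sum-comm λ z y → χ (adj z x) · χ (not (adj z y))) ⟩
    sum (λ x → sum (λ y → sum (λ z → χ (adj z x) · χ (not (adj z y)))))
      ≡⟨ sum-cong-≗ (λ x → sum-cong-≗ λ y → sum-cong-≗ λ z → only x y z) ⟩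
    sum (λ x → sum (λ y → sum (χ ∘ only₁ x y)))
      ≤⟨ double-sum-mono (λ x y → ℕₚ.m≤m+n (sum (χ ∘ only₁ x y)) (sum (χ ∘ only₂ x y))) ⟩
    double-sum distance ∎
    where
    open ≤-Reasoning
    only : ∀ x y z → χ (adj z x) · χ (not (adj z y)) ≡ χ (only₁ x y z)
    only x y z rewrite symmetric z x | symmetric z y with adj x z
    ... | true  = ℕₚ.+-identityʳ _
    ... | false = refl

  -- Each twin pair contributes at most `K · n`, and every other pair at most `suc l · n`. Splitting
  -- `suc l` as `1 + l` bounds the total of the latter by `suc L` times `n³`.
  few-distinct⇒ : ∀ l K L (ν : Fin n → Fin n → Bool) →
    (∀ x y → ν x y ≡ false → suc l · distance x y ≼ K · n) →
    l · double-sum (λ x y → χ (ν x y)) ≼ L · (n · n) →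
    suc l · sum (λ z → D z · D̄ z) ≼ (K + suc L) · (n · n · n)
  few-distinct⇒ l K L ν twins few = begin
    suc l · sum (λ z → D z · D̄ z)                               ≤⟨ ℕₚ.*-monoʳ-≤ (suc l) ∑-distance ⟩
    suc l · double-sum distance                                  ≡⟨ double-sum-*ˡ (suc l) distance ⟨
    double-sum (λ x y → suc l · distance x y)                    ≤⟨ double-sum-mono bound ⟩
    double-sum (λ x y → K · n + suc l · n · χ (ν x y))           ≡⟨ double-sum-+ (λ _ _ → K · n) (λ x y → suc l · n · χ (ν x y)) ⟩
    double-sum {n} (λ _ _ → K · n) + double-sum (λ x y → suc l · n · χ (ν x y))
                                                                 ≡⟨ cong₂ _+_ (double-sum-const {n} (K · n)) (double-sum-*ˡ (suc l · n) (λ x y → χ (ν x y))) ⟩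
    n · n · (K · n) + suc l · n · g                              ≡⟨ shuffle₁ n K l g ⟩
    n · n · (K · n) + n · (g + l · g)                            ≤⟨ ℕₚ.+-monoʳ-≤ (n · n · (K · n)) (ℕₚ.*-monoʳ-≤ n (ℕₚ.+-mono-≤ g≤n² few)) ⟩
    n · n · (K · n) + n · (n · n + L · (n · n))                  ≡⟨ shuffle₂ n K L ⟩
    (K + suc L) · (n · n · n)                                    ∎
    where
    open ≤-Reasoning
    g = double-sum λ x y → χ (ν x y)
    g≤n² : g ≼ n · n
    g≤n² = ℕₚ.≤-trans (double-sum-mono λ x y → χ≤1 (ν x y)) (ℕₚ.≤-reflexive (trans (double-sum-const {n} 1) (ℕₚ.*-identityʳ (n · n))))
    shuffle₁ : ∀ n K l g → n · n · (K · n) + suc l · n · g ≡ n · n · (K · n) + n · (g + l · g)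
    shuffle₁ = solve-∀
    shuffle₂ : ∀ n K L → n · n · (K · n) + n · (n · n + L · (n · n)) ≡ (K + suc L) · (n · n · n)
    shuffle₂ = solve-∀
    bound : ∀ x y → suc l · distance x y ≼ K · n + suc l · n · χ (ν x y)
    bound x y with ν x y in νxy
    ... | false = ℕₚ.≤-trans (twins x y νxy) (ℕₚ.m≤m+n (K · n) _)
    ... | true  = ℕₚ.≤-trans (ℕₚ.*-monoʳ-≤ (suc l) (distance≤n x y))
                    (ℕₚ.≤-trans (ℕₚ.≤-reflexive (sym (ℕₚ.*-identityʳ (suc l · n)))) (ℕₚ.m≤n+m _ (K · n)))

  -- Markov's inequality. If `X₂ f ≡ t`, both `X₂ f` and `Y₂ f` are at least `8 (1 + c) k` and their
  -- sum is `k²`, so their product is at least `4 (1 + c) k³`. By `X₂·Y₂≤` the word then has at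
  -- least `2 (1 + c) k²` mixed cherries, twice the bound on the mean.
  few-mixed⇒ : ∀ l t c → 8 · suc c · suc l ≼ t → t + 8 · suc c · suc l ≼ suc l · suc l →
    ∑ʷ (suc l) mixed ≼ suc l · suc l · (suc c · n ^ suc l) →
    2 · ∑ʷ (suc l) (λ f → δ (X₂ f) t) ≼ n ^ suc l
  few-mixed⇒ l t c Ck≤t t+Ck≤ few = ℕₚ.*-cancelˡ-≤ (4 · suc c · (k · k · k)) (begin
    4 · suc c · (k · k · k) · (2 · ∑ʷ k (λ f → δ (X₂ f) t))
      ≡⟨ shuffle₁ (suc c) k _ ⟩
    8 · suc c · k · (k · k) · ∑ʷ k (λ f → δ (X₂ f) t)
      ≡⟨ ∑ʷ-*ˡ k (8 · suc c · k · (k · k)) (λ f → δ (X₂ f) t) ⟨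
    ∑ʷ k (λ f → 8 · suc c · k · (k · k) · δ (X₂ f) t)
      ≤⟨ ∑ʷ-mono-length k bound ⟩
    ∑ʷ k (λ f → 4 · k · mixed f)
      ≡⟨ ∑ʷ-*ˡ k (4 · k) mixed ⟩
    4 · k · ∑ʷ k mixed
      ≤⟨ ℕₚ.*-monoʳ-≤ (4 · k) few ⟩
    4 · k · (k · k · (suc c · n ^ k))
      ≡⟨ shuffle₂ (suc c) k (n ^ k) ⟩
    4 · suc c · (k · k · k) · n ^ k ∎)
    where
    open ≤-Reasoning
    k = suc l
    shuffle₁ : ∀ c k s → 4 · c · (k · k · k) · (2 · s) ≡ 8 · c · k · (k · k) · s
    shuffle₁ = solve-∀
    shuffle₂ : ∀ c k p → 4 · k · (k · k · (c · p)) ≡ 4 · c · (k · k · k) · p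
    shuffle₂ = solve-∀
    product-large : ∀ {a x y} → a ≼ x → a ≼ y → a · (x + y) ≼ 2 · (x · y)
    product-large {a} {x} {y} a≤x a≤y = begin
      a · (x + y)       ≡⟨ ℕₚ.*-distribˡ-+ a x y ⟩
      a · x + a · y     ≤⟨ ℕₚ.+-mono-≤ (ℕₚ.*-monoˡ-≤ x a≤y) (ℕₚ.*-monoˡ-≤ y a≤x) ⟩
      y · x + x · y     ≡⟨ regroup x y ⟩
      2 · (x · y)       ∎
      where
      regroup : ∀ x y → y · x + x · y ≡ 2 · (x · y)
      regroup = solve-∀
    bound : ∀ f → length f ≡ k → 8 · suc c · k · (k · k) · δ (X₂ f) t ≼ 4 · k · mixed f
    bound f |f|≡k with X₂ f ℕ.≟ t
    ... | no X≢t rewrite δ-≢ X≢t = ℕₚ.≤-trans (ℕₚ.≤-reflexive (ℕₚ.*-zeroʳ (8 · suc c · k · (k · k)))) z≤n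
    ... | yes X≡t = begin
      a · (k · k) · δ (X₂ f) t         ≤⟨ ℕₚ.*-monoʳ-≤ (a · (k · k)) (χ≤1 (X₂ f ℕ.≡ᵇ t)) ⟩
      a · (k · k) · 1                  ≡⟨ ℕₚ.*-identityʳ _ ⟩
      a · (k · k)                      ≡⟨ cong (a ·_) X+Y ⟨
      a · (X₂ f + Y₂ f)                ≤⟨ product-large (subst (a ≼_) (sym X≡t) Ck≤t) a≤Y ⟩
      2 · (X₂ f · Y₂ f)                ≤⟨ ℕₚ.*-monoʳ-≤ 2 (X₂·Y₂≤ f) ⟩
      2 · (2 · (length f · mixed f))   ≡⟨ cong (λ j → 2 · (2 · (j · mixed f))) |f|≡k ⟩
      2 · (2 · (k · mixed f))          ≡⟨ regroup k (mixed f) ⟩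
      4 · k · mixed f                  ∎
      where
      a = 8 · suc c · k
      X+Y : X₂ f + Y₂ f ≡ k · k
      X+Y = trans (X₂+Y₂ f) (cong (λ j → j · j) |f|≡k)
      a≤Y : a ≼ Y₂ f
      a≤Y = ℕₚ.+-cancelˡ-≤ t a (Y₂ f) (ℕₚ.≤-trans t+Ck≤ (ℕₚ.≤-reflexive (trans (sym X+Y) (cong (_+ Y₂ f) X≡t))))
      regroup : ∀ a b → 2 · (2 · (a · b)) ≡ 4 · a · b
      regroup = solve-∀

-- Many distinguishable pairs or mostly twins: the bound for random words

threshold : ℕ → ℕ
threshold L = let R = 3 · (suc L · suc L); J = (R + R) · (R + R) in (J + J) · R

random-word : ∀ {n} .{{_ : ℕ.NonZero n}} (adj : Fin n → Fin n → Bool)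
  (symmetric : ∀ x y → adj x y ≡ adj y x) (irreflexive : ∀ x → adj x x ≡ false) →
  let open Graph adj symmetric irreflexive in
  ∀ L l t → let c = 8 · suc (threshold L + suc L) in
  c · suc l ≼ t → t + c · suc l ≼ suc l · suc l →
  2 · suc L · ∑ʷ (suc l) (λ f → δ (X₂ f) t) ≼ (4 + L) · n ^ suc l
random-word {n} adj symmetric irreflexive L l t Ck≤t t+Ck≤ with ℕₚ.≤-total (L · (n · n)) (l · Resampling.g ν)
  where
  open Graph adj symmetric irreflexive
  ν : Fin n → Fin n → Bool
  -- This is the hypothesis of `few-ties` for `R = 3 (1 + L)²`. A pair outside ν differs in at most
  -- `threshold L · n / k` vertices, which is what `few-distinct⇒` requires.
  ν x y = threshold L · n ℕ.≤ᵇ suc l · distance x y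
... | inj₁ many = Resampling.many-pairs _ l L (λ f → δ (X₂ f) t) tie
        (λ f → χ≤1 (X₂ f ℕ.≡ᵇ t)) (λ x y p r _ → both⇒tie t x y p r) rare many
  where
  open Graph adj symmetric irreflexive
  instance
    _ : ℕ.NonZero (3 · (suc L · suc L))
    _ = ℕₚ.m*n≢0 3 (suc L · suc L)
  rare : ∀ x y → (threshold L · n ℕ.≤ᵇ suc l · distance x y) ≡ true → 3 · (suc L · suc L) · ∑ʷ l (tie x y) ≼ 3 · n ^ l
  rare x y νxy = few-ties (only₁ x y) (only₂ x y) (only-disjoint x y) l (3 · (suc L · suc L))
    (ℕₚ.≤ᵇ⇒≤ (threshold L · n) (suc l · distance x y) (subst Bool.T (sym νxy) _))
... | inj₂ few = begin
    2 · suc L · ∑ʷ (suc l) (λ f → δ (X₂ f) t)    ≡⟨ regroup (suc L) _ ⟩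
    suc L · (2 · ∑ʷ (suc l) (λ f → δ (X₂ f) t))  ≤⟨ ℕₚ.*-monoʳ-≤ (suc L) (few-mixed⇒ l t (threshold L + suc L) Ck≤t t+Ck≤
                                                     (∑ʷ-mixed l (threshold L + suc L) (few-distinct⇒ l (threshold L) L _ twins few))) ⟩
    suc L · n ^ suc l                            ≤⟨ ℕₚ.*-monoˡ-≤ (n ^ suc l) (ℕₚ.m≤n+m (suc L) 3) ⟩
    (4 + L) · n ^ suc l                          ∎
  where
  open ≤-Reasoning
  open Graph adj symmetric irreflexive
  regroup : ∀ a b → 2 · a · b ≡ a · (2 · b)
  regroup = solve-∀
  twins : ∀ x y → (threshold L · n ℕ.≤ᵇ suc l · distance x y) ≡ false → suc l · distance x y ≼ threshold L · n
  twins x y νxy = ℕₚ.≰⇒≥ λ le → subst Bool.T νxy (ℕₚ.≤⇒≤ᵇ le)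

-- Words and k-subsets

∑ˢ : ∀ {n} → (Subset n → ℕ) → ℕ
∑ˢ {zero}  φ = φ []
∑ˢ {suc n} φ = ∑ˢ (λ A → φ (outside ∷ A)) + ∑ˢ (λ A → φ (inside ∷ A))

∑ˢ-cong : ∀ {n} {φ ψ : Subset n → ℕ} → (∀ A → φ A ≡ ψ A) → ∑ˢ φ ≡ ∑ˢ ψ
∑ˢ-cong {zero}  φ≡ψ = φ≡ψ []
∑ˢ-cong {suc n} φ≡ψ = cong₂ _+_ (∑ˢ-cong λ A → φ≡ψ (outside ∷ A)) (∑ˢ-cong λ A → φ≡ψ (inside ∷ A))

∑ˢ-*ˡ : ∀ {n} c (φ : Subset n → ℕ) → ∑ˢ (λ A → c · φ A) ≡ c · ∑ˢ φ
∑ˢ-*ˡ {zero}  c φ = refl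
∑ˢ-*ˡ {suc n} c φ = trans (cong₂ _+_ (∑ˢ-*ˡ c λ A → φ (outside ∷ A)) (∑ˢ-*ˡ c λ A → φ (inside ∷ A)))
  (sym (ℕₚ.*-distribˡ-+ c (∑ˢ λ A → φ (outside ∷ A)) _))

∑ˢ-+ : ∀ {n} (φ ψ : Subset n → ℕ) → ∑ˢ (λ A → φ A + ψ A) ≡ ∑ˢ φ + ∑ˢ ψ
∑ˢ-+ {zero}  φ ψ = refl
∑ˢ-+ {suc n} φ ψ = trans (cong₂ _+_ (∑ˢ-+ (λ A → φ (outside ∷ A)) λ A → ψ (outside ∷ A)) (∑ˢ-+ (λ A → φ (inside ∷ A)) λ A → ψ (inside ∷ A)))
  (interchange (∑ˢ λ A → φ (outside ∷ A)) _ _ _)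
  where
  interchange : ∀ a b c d → (a + b) + (c + d) ≡ (a + c) + (b + d)
  interchange = solve-∀

∑ˢ-zero : ∀ n → ∑ˢ {n} (λ _ → 0) ≡ 0
∑ˢ-zero zero    = refl
∑ˢ-zero (suc n) = cong₂ _+_ (∑ˢ-zero n) (∑ˢ-zero n)

∑ˢ-sum : ∀ {l n} (φ : Fin l → Subset n → ℕ) → ∑ˢ (λ A → sum λ z → φ z A) ≡ sum λ z → ∑ˢ (φ z)
∑ˢ-sum {zero}  {n} φ = ∑ˢ-zero n
∑ˢ-sum {suc l} φ = trans (∑ˢ-+ (φ zero) (λ A → sum λ z → φ (suc z) A)) (cong (∑ˢ (φ zero) +_) (∑ˢ-sum (φ ∘ suc)))

-- Adding `z` is a bijection from the subsets that avoid `z` to those that contain it.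
∑ˢ-insert : ∀ {n} z (G : Subset n → ℕ) →
  ∑ˢ (λ A → χ (not (lookup A z)) · G (A [ z ]≔ inside)) ≡ ∑ˢ (λ B → χ (lookup B z) · G B)
∑ˢ-insert {suc n} zero G = ℕₚ.+-comm (∑ˢ λ A → 1 · G (inside ∷ A)) (∑ˢ {n} λ _ → 0)
∑ˢ-insert (suc z) G = cong₂ _+_ (∑ˢ-insert z λ A → G (outside ∷ A)) (∑ˢ-insert z λ A → G (inside ∷ A))

sum-insert : ∀ {n} (A : Subset n) z (h : Fin n → ℕ) → lookup A z ≡ false →
  sum (λ w → χ (lookup (A [ z ]≔ inside) w) · h w) ≡ h z + sum (λ w → χ (lookup A w) · h w)
sum-insert (false ∷ A) zero    h _   = cong (_+ sum (λ w → χ (lookup A w) · h (suc w))) (ℕₚ.+-identityʳ (h zero))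
sum-insert (b ∷ A)     (suc z) h z∉A = trans
  (cong (χ b · h zero +_) (sum-insert A z (h ∘ suc) z∉A)) (exchange (χ b · h zero) (h (suc z)) _)
  where
  exchange : ∀ a b c → a + (b + c) ≡ b + (a + c)
  exchange = solve-∀

card≡sum : ∀ {n} (A : Subset n) → card A ≡ sum λ z → χ (lookup A z)
card≡sum []          = refl
card≡sum (true ∷ A)  = cong suc (card≡sum A)
card≡sum (false ∷ A) = card≡sum A

card-insert : ∀ {n} (A : Subset n) z → lookup A z ≡ false → card (A [ z ]≔ inside) ≡ suc (card A)
card-insert A z z∉A = begin
  card (A [ z ]≔ inside)                                ≡⟨ card≡sum (A [ z ]≔ inside) ⟩
  sum (λ w → χ (lookup (A [ z ]≔ inside) w))         ≡⟨ sum-cong-≗ (λ w → ℕₚ.*-identityʳ (χ (lookup (A [ z ]≔ inside) w))) ⟨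
  sum (λ w → χ (lookup (A [ z ]≔ inside) w) · 1)     ≡⟨ sum-insert A z (λ _ → 1) z∉A ⟩
  suc (sum (λ w → χ (lookup A w) · 1))               ≡⟨ cong suc (sum-cong-≗ λ w → ℕₚ.*-identityʳ (χ (lookup A w))) ⟩
  suc (sum (λ w → χ (lookup A w)))                   ≡⟨ cong suc (card≡sum A) ⟨
  suc (card A)                                          ∎
  where open ≡-Reasoning

sized : ∀ {n} → ℕ → (Subset n → ℕ) → ℕ
sized k φ = ∑ˢ λ A → δ (card A) k · φ A

-- Double counting of subsets with a marked element `z`, which is then removed.
sized-suc : ∀ {n} k (φ : Subset n → ℕ) →
  suc k · sized (suc k) φ ≡ sum λ z → sized k λ A → χ (not (lookup A z)) · φ (A [ z ]≔ inside)
sized-suc {n} k φ = begin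
  suc k · sized (suc k) φ                                  ≡⟨ ∑ˢ-*ˡ (suc k) G ⟨
  ∑ˢ (λ B → suc k · G B)                                   ≡⟨ ∑ˢ-cong weigh ⟩
  ∑ˢ (λ B → sum λ z → χ (lookup B z) · G B)                ≡⟨ ∑ˢ-sum (λ z B → χ (lookup B z) · G B) ⟩
  sum (λ z → ∑ˢ λ B → χ (lookup B z) · G B)                ≡⟨ sum-cong-≗ (λ z → ∑ˢ-insert z G) ⟨
  sum (λ z → ∑ˢ λ A → χ (not (lookup A z)) · G (A [ z ]≔ inside)) ≡⟨ sum-cong-≗ (λ z → ∑ˢ-cong (remove z)) ⟩
  sum (λ z → sized k λ A → χ (not (lookup A z)) · φ (A [ z ]≔ inside)) ∎
  where
  open ≡-Reasoning
  G : Subset n → ℕ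
  G B = δ (card B) (suc k) · φ B
  weigh : ∀ B → suc k · G B ≡ sum λ z → χ (lookup B z) · G B
  weigh B = begin
    suc k · (δ (card B) (suc k) · φ B)              ≡⟨ ℕₚ.*-assoc (suc k) (δ (card B) (suc k)) (φ B) ⟨
    suc k · δ (card B) (suc k) · φ B                ≡⟨ cong (_· φ B) (δ-subst (λ x → x) (card B) (suc k)) ⟨
    card B · δ (card B) (suc k) · φ B                ≡⟨ ℕₚ.*-assoc (card B) (δ (card B) (suc k)) (φ B) ⟩
    card B · G B                                  ≡⟨ trans (cong (_· G B) (card≡sum B)) (ℕₚ.*-comm _ (G B)) ⟩
    G B · sum (λ z → χ (lookup B z))             ≡⟨ sum-*ˡ (G B) (λ z → χ (lookup B z)) ⟨
    sum (λ z → G B · χ (lookup B z))             ≡⟨ sum-cong-≗ (λ z → ℕₚ.*-comm (G B) (χ (lookup B z))) ⟩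
    sum (λ z → χ (lookup B z) · G B)             ∎
  remove : ∀ z A → χ (not (lookup A z)) · G (A [ z ]≔ inside)
    ≡ δ (card A) k · (χ (not (lookup A z)) · φ (A [ z ]≔ inside))
  remove z A with lookup A z in z∉A
  ... | true  = sym (ℕₚ.*-zeroʳ (δ (card A) k))
  ... | false rewrite card-insert A z z∉A = regroup (δ (card A) k) (φ (A [ z ]≔ inside))
    where
    regroup : ∀ a b → 1 · (a · b) ≡ a · (1 · b)
    regroup = solve-∀

-- Testing against all h makes this say that f lists the elements of A, each once.
Lists : ∀ {n} → List (Fin n) → Subset n → Set
Lists {n} f A = ∀ (h : Fin n → ℕ) → sum (λ z → χ (lookup A z) · h z) ≡ along h f

-- Only one inequality of "every k-subset is listed by k! words" is needed.
sized≤words : ∀ {n} k (φ : Subset n → ℕ) (F : List (Fin n) → ℕ) →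
  (∀ A f → Lists f A → φ A ≼ F f) → k ! · sized k φ ≼ ∑ʷ k F
sized≤words {n} zero φ F φ≤F = ℕₚ.≤-trans (ℕₚ.≤-reflexive (trans (ℕₚ.+-identityʳ (sized 0 φ)) (sized-zero φ)))
  (φ≤F (Vec.replicate n outside) [] empty)
  where
  sized-zero : ∀ {n} (φ : Subset n → ℕ) → sized 0 φ ≡ φ (Vec.replicate n outside)
  sized-zero {zero}  φ = ℕₚ.+-identityʳ (φ [])
  sized-zero {suc n} φ = trans (cong₂ _+_ (sized-zero (λ A → φ (outside ∷ A))) (∑ˢ-zero n)) (ℕₚ.+-identityʳ _)
  empty : ∀ {n} → Lists {n} [] (Vec.replicate n outside)
  empty {zero}  h = refl
  empty {suc n} h = empty (h ∘ suc)
sized≤words {n} (suc k) φ F φ≤F = begin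
  suc k · k ! · sized (suc k) φ                    ≡⟨ regroup (suc k) (k !) (sized (suc k) φ) ⟩
  k ! · (suc k · sized (suc k) φ)                  ≡⟨ cong (k ! ·_) (sized-suc k φ) ⟩
  k ! · sum (λ z → sized k (φ′ z))                 ≡⟨ sum-*ˡ (k !) (λ z → sized k (φ′ z)) ⟨
  sum (λ z → k ! · sized k (φ′ z))                 ≤⟨ sum-mono (λ z → sized≤words k (φ′ z) (λ f → F (z ∷ f)) (extend z)) ⟩
  sum (λ z → ∑ʷ k λ f → F (z ∷ f))                 ∎
  where
  open ≤-Reasoning
  φ′ : Fin n → Subset n → ℕ
  -- The factor vanishes when `z` already lies in `A`, so only words without repeated letters are
  -- charged.
  φ′ z A = χ (not (lookup A z)) · φ (A [ z ]≔ inside)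
  regroup : ∀ a b c → a · b · c ≡ b · (a · c)
  regroup = solve-∀
  extend : ∀ z A f → Lists f A → φ′ z A ≼ F (z ∷ f)
  extend z A f f-lists with lookup A z in z∉A
  ... | true  = z≤n
  ... | false = ℕₚ.≤-trans (ℕₚ.≤-reflexive (ℕₚ.+-identityʳ (φ (A [ z ]≔ inside))))
    (φ≤F (A [ z ]≔ inside) (z ∷ f) λ h → trans (sum-insert A z h z∉A) (cong (h z +_) (f-lists h)))

-- `k ! · sized k (λ _ → 1)` is the number of words without repeated letters, so a random word has a
-- repetition with probability at most `k² / n`. Appending a letter to a word of length `k` adds at
-- most `k / n`, and `k² + k ≤ (k + 1)²`.
many-sized : ∀ n k → n · n ^ k ≼ n · (k ! · sized {n} k (λ _ → 1)) + k · k · n ^ k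
many-sized n k = main k
  where
  open ≤-Reasoning
  a : ℕ → ℕ
  a k = k ! · sized {n} k λ _ → 1
  a≤n^ : ∀ k → a k ≼ n ^ k
  a≤n^ k = ℕₚ.≤-trans (sized≤words {n} k (λ _ → 1) (λ _ → 1) λ _ _ _ → ℕₚ.≤-refl)
    (ℕₚ.≤-reflexive (trans (∑ʷ-const {n} k 1) (ℕₚ.*-identityˡ (n ^ k))))
  outside-count : ∀ (A : Subset n) → card A + sum (λ z → χ (not (lookup A z))) ≡ n
  outside-count A = trans (cong (_+ sum (λ z → χ (not (lookup A z)))) (card≡sum A))
    (trans (sym (sum-+ (λ z → χ (lookup A z)) (λ z → χ (not (lookup A z)))))
      (trans (sum-cong-≗ λ z → complement (lookup A z)) (trans (sum-const n 1) (ℕₚ.*-identityʳ n))))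
    where
    complement : ∀ b → χ b + χ (not b) ≡ 1
    complement true  = refl
    complement false = refl
  -- A `k`-subset is paired with an arbitrary vertex: one outside it gives a larger subset with a
  -- marked element, one inside it can be chosen in `k` ways.
  step : ∀ k → suc k · sized {n} (suc k) (λ _ → 1) + k · sized {n} k (λ _ → 1) ≡ n · sized {n} k (λ _ → 1)
  step k = begin-equality
    suc k · sized {n} (suc k) (λ _ → 1) + k · sized {n} k (λ _ → 1)
      ≡⟨ cong₂ _+_ (trans (sized-suc {n} k (λ _ → 1)) (sym (∑ˢ-sum {n} {n} λ z A → δ (card A) k · (χ (not (lookup A z)) · 1))))
           (sym (∑ˢ-*ˡ {n} k λ A → δ (card A) k · 1)) ⟩
    ∑ˢ {n} (λ A → sum λ z → δ (card A) k · (χ (not (lookup A z)) · 1)) + ∑ˢ {n} (λ A → k · (δ (card A) k · 1))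
      ≡⟨ ∑ˢ-+ {n} (λ A → sum λ z → δ (card A) k · (χ (not (lookup A z)) · 1)) (λ A → k · (δ (card A) k · 1)) ⟨
    ∑ˢ {n} (λ A → sum (λ z → δ (card A) k · (χ (not (lookup A z)) · 1)) + k · (δ (card A) k · 1))
      ≡⟨ ∑ˢ-cong {n} (λ A → pointwise A) ⟩
    ∑ˢ {n} (λ A → n · (δ (card A) k · 1))
      ≡⟨ ∑ˢ-*ˡ {n} n (λ A → δ (card A) k · 1) ⟩
    n · sized {n} k (λ _ → 1) ∎
    where
    pointwise : ∀ A → sum (λ z → δ (card A) k · (χ (not (lookup A z)) · 1)) + k · (δ (card A) k · 1) ≡ n · (δ (card A) k · 1)
    pointwise A = begin-equality
      sum (λ z → δ (card A) k · (χ (not (lookup A z)) · 1)) + k · (δ (card A) k · 1)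
        ≡⟨ cong₂ _+_ (trans (sum-*ˡ (δ (card A) k) λ z → χ (not (lookup A z)) · 1)
             (cong (δ (card A) k ·_) (sum-cong-≗ λ z → ℕₚ.*-identityʳ (χ (not (lookup A z))))))
             (trans (cong (k ·_) (ℕₚ.*-identityʳ (δ (card A) k))) (sym (δ-subst (λ x → x) (card A) k))) ⟩
      δ (card A) k · o + card A · δ (card A) k    ≡⟨ regroup (δ (card A) k) o (card A) ⟩
      (card A + o) · (δ (card A) k · 1)        ≡⟨ cong (_· (δ (card A) k · 1)) (outside-count A) ⟩
      n · (δ (card A) k · 1)                  ∎
      where
      o = sum λ z → χ (not (lookup A z))
      regroup : ∀ d o a → d · o + a · d ≡ (a + o) · (d · 1)
      regroup = solve-∀
  main : ∀ k → n · n ^ k ≼ n · a k + k · k · n ^ k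
  main zero    = ℕₚ.≤-trans (ℕₚ.*-monoʳ-≤ n (ℕₚ.≤-reflexive (sym a0))) (ℕₚ.m≤m+n _ 0)
    where
    a0 : a 0 ≡ 1
    a0 = trans (ℕₚ.+-identityʳ _) (one n)
      where
      one : ∀ n → sized {n} 0 (λ _ → 1) ≡ 1
      one zero    = refl
      one (suc n) = trans (cong₂ _+_ (one n) (∑ˢ-zero n)) refl
  main (suc k) = begin
    n · (n · n ^ k)                                            ≤⟨ ℕₚ.*-monoʳ-≤ n (main k) ⟩
    n · (n · a k + k · k · n ^ k)                              ≡⟨ cong (λ t → n · (t + k · k · n ^ k)) n·a ⟩
    n · (a (suc k) + k · a k + k · k · n ^ k)                  ≤⟨ ℕₚ.*-monoʳ-≤ n (ℕₚ.+-monoˡ-≤ (k · k · n ^ k) (ℕₚ.+-monoʳ-≤ (a (suc k)) (ℕₚ.*-monoʳ-≤ k (a≤n^ k)))) ⟩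
    n · (a (suc k) + k · n ^ k + k · k · n ^ k)                ≤⟨ ℕₚ.m≤m+n _ (suc k · (n · n ^ k)) ⟩
    n · (a (suc k) + k · n ^ k + k · k · n ^ k) + suc k · (n · n ^ k) ≡⟨ regroup n (a (suc k)) k (n ^ k) ⟩
    n · a (suc k) + suc k · suc k · (n · n ^ k)                ∎
    where
    regroup : ∀ n a k p → n · (a + k · p + k · k · p) + suc k · (n · p) ≡ n · a + suc k · suc k · (n · p)
    regroup = solve-∀
    n·a : n · a k ≡ a (suc k) + k · a k
    n·a = begin-equality
      n · (k ! · s)                           ≡⟨ swap n (k !) s ⟩
      k ! · (n · s)                           ≡⟨ cong (k ! ·_) (step k) ⟨
      k ! · (suc k · s′ + k · s)              ≡⟨ expand (k !) k s′ s ⟩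
      suc k · k ! · s′ + k · (k ! · s)        ∎
      where
      s = sized {n} k λ _ → 1
      s′ = sized {n} (suc k) λ _ → 1
      swap : ∀ a b c → a · (b · c) ≡ b · (a · c)
      swap = solve-∀
      expand : ∀ q k s t → q · (suc k · s + k · t) ≡ suc k · q · s + k · (q · t)
      expand = solve-∀

-- Lists of subsets and their lengths as sums

along-++ : ∀ {A : Set} (h : A → ℕ) p r → along h (p ++ r) ≡ along h p + along h r
along-++ h []      r = refl
along-++ h (x ∷ p) r = trans (cong (h x +_) (along-++ h p r)) (sym (ℕₚ.+-assoc (h x) _ _))

along-map : ∀ {A B : Set} (h : B → ℕ) (f : A → B) xs → along h (List.map f xs) ≡ along (h ∘ f) xs
along-map h f []       = refl
along-map h f (x ∷ xs) = cong (h (f x) +_) (along-map h f xs)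

along-cartesianProductWith : ∀ {A B E : Set} (h : E → ℕ) (f : A → B → E) xs ys →
  along h (List.cartesianProductWith f xs ys) ≡ along (λ x → along (λ y → h (f x y)) ys) xs
along-cartesianProductWith h f []       ys = refl
along-cartesianProductWith h f (x ∷ xs) ys = trans (along-++ h (List.map (f x) ys) _)
  (cong₂ _+_ (along-map h (f x) ys) (along-cartesianProductWith h f xs ys))

along-tabulate : ∀ {A : Set} {n} (h : A → ℕ) (g : Fin n → A) → along h (List.tabulate g) ≡ sum (h ∘ g)
along-tabulate {n = zero}  h g = refl
along-tabulate {n = suc n} h g = cong (h (g zero) +_) (along-tabulate h (g ∘ suc))

along-filter : ∀ {A : Set} {P : Pred A 0ℓ} (P? : Decidable P) (h : A → ℕ) xs →
  along h (List.filter P? xs) ≡ along (λ x → χ (does (P? x)) · h x) xs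
along-filter P? h []       = refl
along-filter P? h (x ∷ xs) with does (P? x)
... | true  = cong₂ _+_ (sym (ℕₚ.+-identityʳ (h x))) (along-filter P? h xs)
... | false = along-filter P? h xs

length-along : ∀ {A : Set} (xs : List A) → length xs ≡ along (λ _ → 1) xs
length-along xs = sym (trans (along-const 1 xs) (ℕₚ.*-identityʳ (length xs)))

along-subsets : ∀ n (φ : Subset n → ℕ) → along φ (vectors (outside ∷ inside ∷ []) n) ≡ ∑ˢ φ
along-subsets zero    φ = ℕₚ.+-identityʳ (φ [])
along-subsets (suc n) φ = trans (along-cartesianProductWith φ _∷_ (outside ∷ inside ∷ []) (vectors (outside ∷ inside ∷ []) n))
  (cong₂ _+_ (along-subsets n λ A → φ (outside ∷ A))
    (trans (ℕₚ.+-identityʳ _) (along-subsets n λ A → φ (inside ∷ A))))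

length-kSubsets : ∀ n k → length (kSubsets n k) ≡ sized {n} k (λ _ → 1)
length-kSubsets n k = trans (length-along (kSubsets n k))
  (trans (along-filter _ (λ _ → 1) (vectors (outside ∷ inside ∷ []) n)) (along-subsets n _))

length-filter-kSubsets : ∀ {n} k {P : Pred (Subset n) 0ℓ} (P? : Decidable P) →
  length (List.filter P? (kSubsets n k)) ≡ sized k (λ A → χ (does (P? A)))
length-filter-kSubsets {n} k P? = trans (length-along (List.filter P? (kSubsets n k)))
  (trans (along-filter P? (λ _ → 1) (kSubsets n k))
    (trans (along-filter _ (λ A → χ (does (P? A)) · 1) (vectors (outside ∷ inside ∷ []) n))
      (trans (along-subsets n _) (∑ˢ-cong {n} λ A → cong (δ (card A) k ·_) (ℕₚ.*-identityʳ (χ (does (P? A))))))))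

-- Edge counts of k-subsets

module _ {n : ℕ} (G : Matrix n) (simple : IsSimpleGraph G) where

  open Graph (entry G) (proj₁ simple) (proj₂ simple)

  -- The condition `i < j` keeps one orientation of every edge. Adding the transpose supplies the
  -- other, and the diagonal is empty because there are no loops.
  edgeCount-double : ∀ A → edgeCount G A + edgeCount G A
    ≡ double-sum λ i j → χ (lookup A i) · (χ (lookup A j) · χ (entry G i j))
  edgeCount-double A = begin
    edgeCount G A + edgeCount G A                      ≡⟨ cong₂ _+_ count (trans count (sum-comm e)) ⟩
    double-sum e + double-sum (λ i j → e j i)          ≡⟨ double-sum-+ e (λ i j → e j i) ⟨
    double-sum (λ i j → e i j + e j i)                 ≡⟨ double-sum-cong oriented ⟩
    double-sum (λ i j → χ (lookup A i) · (χ (lookup A j) · χ (entry G i j))) ∎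
    where
    open ≡-Reasoning
    e : Fin n → Fin n → ℕ
    e i j = χ (does (isEdgeWithin? G A (i , j)))
    pairs : List (Fin n × Fin n)
    pairs = List.cartesianProduct (List.allFin n) (List.allFin n)
    count : edgeCount G A ≡ double-sum e
    count = begin
      edgeCount G A
        ≡⟨ trans (length-along (List.filter (isEdgeWithin? G A) pairs)) (along-filter (isEdgeWithin? G A) (λ _ → 1) pairs) ⟩
      along (λ ij → χ (does (isEdgeWithin? G A ij)) · 1) pairs
        ≡⟨ along-cong (λ ij → ℕₚ.*-identityʳ (χ (does (isEdgeWithin? G A ij)))) pairs ⟩
      along (λ ij → χ (does (isEdgeWithin? G A ij))) pairs
        ≡⟨ along-cartesianProductWith (λ ij → χ (does (isEdgeWithin? G A ij))) _,_ (List.allFin n) (List.allFin n) ⟩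
      along (λ i → along (e i) (List.allFin n)) (List.allFin n)
        ≡⟨ trans (along-tabulate (λ i → along (e i) (List.allFin n)) (λ i → i)) (sum-cong-≗ λ i → along-tabulate (e i) (λ j → j)) ⟩
      double-sum e ∎
    ∈?-lookup : ∀ i → does (i ∈ₛ? A) ≡ lookup A i
    ∈?-lookup i with lookup A i in eq
    ... | true  = dec-true (i ∈ₛ? A) (lookup⇒[]= i A eq)
    ... | false = dec-false (i ∈ₛ? A) λ i∈A → false≢true (trans (sym eq) ([]=⇒lookup i∈A))
      where
      false≢true : ¬ false ≡ true
      false≢true ()
    ≟-true : ∀ b → does (b Bool.≟ true) ≡ b
    ≟-true true  = refl
    ≟-true false = refl
    χ-∧ : ∀ a b → χ (a ∧ b) ≡ χ a · χ b
    χ-∧ true  b = sym (ℕₚ.+-identityʳ (χ b))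
    χ-∧ false b = refl
    e≡ : ∀ i j → e i j ≡ χ (does (i Fin.<? j)) · (χ (lookup A i) · (χ (lookup A j) · χ (entry G i j)))
    e≡ i j rewrite ∈?-lookup i | ∈?-lookup j | ≟-true (entry G i j)
      = trans (χ-∧ (does (i Fin.<? j)) _) (cong (χ (does (i Fin.<? j)) ·_)
          (trans (χ-∧ (lookup A i) _) (cong (χ (lookup A i) ·_) (χ-∧ (lookup A j) (entry G i j)))))
    oriented : ∀ i j → e i j + e j i ≡ χ (lookup A i) · (χ (lookup A j) · χ (entry G i j))
    oriented i j rewrite e≡ i j | e≡ j i | proj₁ simple j i with Fin.<-cmp i j
    ... | tri< i<j _ j≮i rewrite dec-true (i Fin.<? j) i<j | dec-false (j Fin.<? i) j≮i
        = regroup (χ (lookup A i)) (χ (lookup A j)) (χ (entry G i j))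
        where
        regroup : ∀ a b c → 1 · (a · (b · c)) + 0 ≡ a · (b · c)
        regroup = solve-∀
    ... | tri> i≮j _ j<i rewrite dec-false (i Fin.<? j) i≮j | dec-true (j Fin.<? i) j<i
        = regroup (χ (lookup A i)) (χ (lookup A j)) (χ (entry G i j))
        where
        regroup : ∀ a b c → 0 + 1 · (b · (a · c)) ≡ a · (b · c)
        regroup = solve-∀
    ... | tri≈ i≮i refl _ rewrite dec-false (i Fin.<? i) i≮i | proj₂ simple i
        = sym (regroup (χ (lookup A i)))
        where
        regroup : ∀ a → a · (a · 0) ≡ 0
        regroup = solve-∀

  -- The test property of `Lists` is used twice: on the indicator of each neighbourhood, and on the
  -- degree function that results.
  X₂-lists : ∀ A f → Lists f A → X₂ f ≡ 2 · edgeCount G A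
  X₂-lists A f f-lists = begin
    along (λ z → deg z f) f
      ≡⟨ along-cong (λ z → sym (f-lists (λ w → χ (entry G z w)))) f ⟩
    along (λ z → sum λ w → χ (lookup A w) · χ (entry G z w)) f
      ≡⟨ f-lists (λ z → sum λ w → χ (lookup A w) · χ (entry G z w)) ⟨
    sum (λ z → χ (lookup A z) · sum λ w → χ (lookup A w) · χ (entry G z w))
      ≡⟨ sum-cong-≗ (λ z → sum-*ˡ (χ (lookup A z)) (λ w → χ (lookup A w) · χ (entry G z w))) ⟨
    double-sum (λ z w → χ (lookup A z) · (χ (lookup A w) · χ (entry G z w)))
      ≡⟨ edgeCount-double A ⟨
    edgeCount G A + edgeCount G A
      ≡⟨ cong (edgeCount G A +_) (ℕₚ.+-identityʳ (edgeCount G A)) ⟨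
    2 · edgeCount G A ∎
    where open ≡-Reasoning

  few-subsets : ∀ L l ℓ .{{_ : ℕ.NonZero n}} → let c = 8 · suc (threshold L + suc L); k = suc l in
    c · k ≼ 2 · ℓ → 2 · ℓ + c · k ≼ k · k →
    2 · suc L · (k ! · length (List.filter (λ A → edgeCount G A ℕ.≟ ℓ) (kSubsets n k))) ≼ (4 + L) · n ^ k
  few-subsets L l ℓ lo hi = begin
    2 · suc L · (suc l ! · length (List.filter (λ A → edgeCount G A ℕ.≟ ℓ) (kSubsets n (suc l))))
      ≡⟨ cong (λ t → 2 · suc L · (suc l ! · t)) (length-filter-kSubsets (suc l) (λ A → edgeCount G A ℕ.≟ ℓ)) ⟩
    2 · suc L · (suc l ! · sized (suc l) (λ A → δ (edgeCount G A) ℓ))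
      ≤⟨ ℕₚ.*-monoʳ-≤ (2 · suc L) (sized≤words (suc l) (λ A → δ (edgeCount G A) ℓ) (λ f → δ (X₂ f) (2 · ℓ)) transfer) ⟩
    2 · suc L · ∑ʷ (suc l) (λ f → δ (X₂ f) (2 · ℓ))
      ≤⟨ random-word (entry G) (proj₁ simple) (proj₂ simple) L l (2 · ℓ) lo hi ⟩
    (4 + L) · n ^ suc l ∎
    where
    open ≤-Reasoning
    transfer : ∀ A f → Lists f A → δ (edgeCount G A) ℓ ≼ δ (X₂ f) (2 · ℓ)
    transfer A f f-lists with edgeCount G A ℕ.≟ ℓ
    ... | no ≢ℓ rewrite δ-≢ ≢ℓ = z≤n
    ... | yes refl rewrite X₂-lists A f f-lists | δ-refl (2 · edgeCount G A) = χ≤1 (edgeCount G A ℕ.≡ᵇ edgeCount G A)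

-- From counts to probabilities

-- Opened only here because the prefix +_ would make sections of addition ambiguous.
open import Data.Integer as ℤ using (+_)

toℚᵘ-/ : ∀ a b → ℚ.toℚᵘ (+ a / suc b) ℚᵘ.≃ mkℚᵘ (+ a) b
toℚᵘ-/ a b = ℚ.toℚᵘ-fromℚᵘ (mkℚᵘ (+ a) b)

fromℕ : ℕ → ℚ
fromℕ a = + a / 1

fromℕ-cancel-≤ : ∀ {a b} → fromℕ a ℚ.≤ fromℕ b → a ≼ b
fromℕ-cancel-≤ {a} {b} a≤b with ℚᵘ.≤-respˡ-≃ (toℚᵘ-/ a 0) (ℚᵘ.≤-respʳ-≃ (toℚᵘ-/ b 0) (ℚ.toℚᵘ-mono-≤ a≤b))
... | ℚᵘ.*≤* le = ℤ.drop‿+≤+ (subst (ℤ._≤ + b) (ℤ.*-identityʳ (+ a)) (subst (+ a ℤ.* + 1 ℤ.≤_) (ℤ.*-identityʳ (+ b)) le))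

fromℕ-* : ∀ a b → fromℕ a * fromℕ b ≡ fromℕ (a · b)
fromℕ-* a b = ℚ.toℚᵘ-injective (begin-equality
  ℚ.toℚᵘ (fromℕ a * fromℕ b)                  ≃⟨ ℚ.toℚᵘ-homo-* (fromℕ a) (fromℕ b) ⟩
  ℚ.toℚᵘ (fromℕ a) ℚᵘ.* ℚ.toℚᵘ (fromℕ b)      ≃⟨ ℚᵘ.*-cong (toℚᵘ-/ a 0) (toℚᵘ-/ b 0) ⟩
  mkℚᵘ (+ a ℤ.* + b) 0                        ≡⟨ cong (λ i → mkℚᵘ i 0) (ℤ.pos-* a b) ⟨
  mkℚᵘ (+ (a · b)) 0                          ≃⟨ toℚᵘ-/ (a · b) 0 ⟨
  ℚ.toℚᵘ (fromℕ (a · b))                      ∎)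
  where open ℚᵘ.≤-Reasoning

fromℕ-+ : ∀ a b → fromℕ a ℚ.+ fromℕ b ≡ fromℕ (a + b)
fromℕ-+ a b = ℚ.toℚᵘ-injective (begin-equality
  ℚ.toℚᵘ (fromℕ a ℚ.+ fromℕ b)                ≃⟨ ℚ.toℚᵘ-homo-+ (fromℕ a) (fromℕ b) ⟩
  ℚ.toℚᵘ (fromℕ a) ℚᵘ.+ ℚ.toℚᵘ (fromℕ b)      ≃⟨ ℚᵘ.+-cong (toℚᵘ-/ a 0) (toℚᵘ-/ b 0) ⟩
  mkℚᵘ (+ a ℤ.* + 1 ℤ.+ + b ℤ.* + 1) 0        ≡⟨ cong₂ (λ i j → mkℚᵘ (i ℤ.+ j) 0) (ℤ.*-identityʳ (+ a)) (ℤ.*-identityʳ (+ b)) ⟩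
  mkℚᵘ (+ (a + b)) 0                          ≃⟨ toℚᵘ-/ (a + b) 0 ⟨
  ℚ.toℚᵘ (fromℕ (a + b))                      ∎)
  where open ℚᵘ.≤-Reasoning

-- A positive rational is at least the reciprocal of its denominator `D`, and the counting bound
-- says that the probability is at most `(2 + D) / (2 D) = 1/2 + 1/D`.
ℙ≤½+ : ∀ {A : Set} {P : Pred A 0ℓ} (Ω : List A) (P? : Decidable P) (δ : ℚ) → 0ℚ ℚ.< δ →
  2 · ℚ.↧ₙ δ · length (List.filter P? Ω) ≼ (2 + ℚ.↧ₙ δ) · length Ω → ℙ Ω P? ℚ.≤ ½ ℚ.+ δ
ℙ≤½+ [] P? δ 0<δ _ = ℚ.≤-trans (ℚ.nonNegative⁻¹ ½) (ℚ.≤-trans (ℚ.≤-reflexive (sym (ℚ.+-identityʳ ½))) (ℚ.+-monoʳ-≤ ½ (ℚ.<⇒≤ 0<δ)))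
ℙ≤½+ Ω@(_ ∷ ωs) P? (ℚ.mkℚ (+ zero) d _) (ℚ.*<* (ℤ.+<+ ())) few
ℙ≤½+ Ω@(_ ∷ ωs) P? (ℚ.mkℚ (ℤ.-[1+ p ]) d _) (ℚ.*<* ()) few
ℙ≤½+ Ω@(_ ∷ ωs) P? δ@(ℚ.mkℚ (+ suc p) d _) 0<δ few = ℚ.toℚᵘ-cancel-≤ (begin
  ℚ.toℚᵘ (+ a / suc b)                       ≃⟨ toℚᵘ-/ a b ⟩
  mkℚᵘ (+ a) b                               ≤⟨ ℚᵘ.*≤* cross ⟩
  mkℚᵘ (+ 1) 1 ℚᵘ.+ mkℚᵘ (+ suc p) d         ≃⟨ ℚ.toℚᵘ-homo-+ ½ δ ⟨
  ℚ.toℚᵘ (½ ℚ.+ δ)                           ∎)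
  where
  open ℚᵘ.≤-Reasoning
  a = length (List.filter P? Ω)
  b = length ωs
  D = suc d
  crossℕ : a · (2 · D) ≼ (1 · D + suc p · 2) · suc b
  crossℕ = ℕₚ.≤-trans (ℕₚ.≤-reflexive (ℕₚ.*-comm a (2 · D))) (ℕₚ.≤-trans few (ℕₚ.*-monoˡ-≤ (suc b)
    (ℕₚ.≤-trans (ℕₚ.m≤m+n (2 + D) (p · 2)) (ℕₚ.≤-reflexive (regroup D p)))))
    where
    regroup : ∀ D p → 2 + D + p · 2 ≡ 1 · D + suc p · 2
    regroup = solve-∀
  cross : + a ℤ.* (+ 2 ℤ.* + D) ℤ.≤ (+ 1 ℤ.* + D ℤ.+ + suc p ℤ.* + 2) ℤ.* + suc b
  cross = subst₂ ℤ._≤_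
    (trans (ℤ.pos-* a (2 · D)) (cong (+ a ℤ.*_) (ℤ.pos-* 2 D)))
    (trans (ℤ.pos-* (1 · D + suc p · 2) (suc b)) (cong (ℤ._* + suc b) (cong₂ ℤ._+_ (ℤ.pos-* 1 D) (ℤ.pos-* (suc p) 2))))
    (ℤ.+≤+ crossℕ)

2·kC2≤k² : ∀ k → 2 · (k C 2) ≼ k · k
2·kC2≤k² zero    = z≤n
2·kC2≤k² (suc k) = begin
  2 · (suc k C 2)          ≡⟨ cong (2 ·_) (nCk+nC[k+1]≡[n+1]C[k+1] k 1) ⟨
  2 · (k C 1 + k C 2)      ≡⟨ cong (λ t → 2 · (t + k C 2)) (nC1≡n k) ⟩
  2 · (k + k C 2)          ≡⟨ ℕₚ.*-distribˡ-+ 2 k (k C 2) ⟩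
  2 · k + 2 · (k C 2)      ≤⟨ ℕₚ.+-monoʳ-≤ (2 · k) (2·kC2≤k² k) ⟩
  2 · k + k · k            ≤⟨ ℕₚ.n≤1+n _ ⟩
  suc (2 · k + k · k)      ≡⟨ regroup k ⟩
  suc k · suc k            ∎
  where
  open ≤-Reasoning
  regroup : ∀ k → suc (2 · k + k · k) ≡ suc k · suc k
  regroup = solve-∀

-- The choice of L makes (4 + L) / 2 (1 + L) equal to 1/2 + 1/2 (1 + d).
constant : ℕ → ℕ
constant d = let L = 2 + 3 · d in 8 · suc (threshold L + suc L)

-- For random words the bound is `1/2 + 1/(2 D)`. Passing to subsets divides it by the proportion of
-- words without repetitions; once `n ≥ (2 + D) k²`, this costs at most another `1/(2 D)`.
few-kSubsets : ∀ d l ℓ n .{{_ : ℕ.NonZero n}} → let k = suc l; D = suc d in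
  constant d · k ≼ ℓ → ℓ + constant d · k ≼ k C 2 → (2 + D) · (k · k) ≼ n →
  (G : Matrix n) → IsSimpleGraph G →
  2 · D · length (List.filter (λ A → edgeCount G A ℕ.≟ ℓ) (kSubsets n k)) ≼ (2 + D) · length (kSubsets n k)
few-kSubsets d l ℓ n lo hi big G simple = ℕₚ.*-cancelˡ-≤ (n · k !) (begin
  n · k ! · (2 · D · good)                                    ≡⟨ shuffle₁ n (k !) D good ⟩
  n · (2 · D · (k ! · good))                                  ≤⟨ ℕₚ.*-monoʳ-≤ n few ⟩
  n · (suc D · n ^ k)                                         ≡⟨ shuffle₂ n D (n ^ k) ⟩
  suc D · (n · n ^ k)                                         ≤⟨ ℕₚ.*-monoʳ-≤ (suc D) many ⟩
  suc D · (n · (k ! · total) + k · k · n ^ k)                 ≡⟨ ℕₚ.*-distribˡ-+ (suc D) (n · (k ! · total)) _ ⟩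
  suc D · (n · (k ! · total)) + suc D · (k · k · n ^ k)       ≤⟨ ℕₚ.+-monoʳ-≤ (suc D · (n · (k ! · total))) rest ⟩
  suc D · (n · (k ! · total)) + n · (k ! · total)             ≡⟨ shuffle₃ D n (k !) total ⟩
  n · k ! · ((2 + D) · total)                                 ∎)
  where
  open ≤-Reasoning
  k = suc l
  D = suc d
  L = 2 + 3 · d
  good = length (List.filter (λ A → edgeCount G A ℕ.≟ ℓ) (kSubsets n k))
  total = length (kSubsets n k)
  instance
    _ : ℕ.NonZero (k !)
    _ = k ℕₚ.!≢0
    _ : ℕ.NonZero (n · k !)
    _ = ℕₚ.m*n≢0 n (k !)
  shuffle₁ : ∀ n q D g → n · q · (2 · D · g) ≡ n · (2 · D · (q · g))
  shuffle₁ = solve-∀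
  shuffle₂ : ∀ n D p → n · (suc D · p) ≡ suc D · (n · p)
  shuffle₂ = solve-∀
  shuffle₃ : ∀ D n q t → suc D · (n · (q · t)) + n · (q · t) ≡ n · q · ((2 + D) · t)
  shuffle₃ = solve-∀
  few : 2 · D · (k ! · good) ≼ suc D · n ^ k
  few = ℕₚ.*-cancelˡ-≤ 3 (begin
    3 · (2 · D · (k ! · good))       ≡⟨ regroup₁ d (k ! · good) ⟩
    2 · suc L · (k ! · good)         ≤⟨ few-subsets G simple L l ℓ lo′ hi′ ⟩
    (4 + L) · n ^ k                  ≡⟨ regroup₂ d (n ^ k) ⟩
    3 · (suc D · n ^ k)              ∎)
    where
    regroup₁ : ∀ d x → 3 · (2 · suc d · x) ≡ 2 · suc (2 + 3 · d) · x
    regroup₁ = solve-∀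
    regroup₂ : ∀ d x → (4 + (2 + 3 · d)) · x ≡ 3 · (suc (suc d) · x)
    regroup₂ = solve-∀
    lo′ : constant d · k ≼ 2 · ℓ
    lo′ = ℕₚ.≤-trans lo (ℕₚ.m≤m+n ℓ (ℓ + 0))
    hi′ : 2 · ℓ + constant d · k ≼ k · k
    hi′ = begin
      2 · ℓ + constant d · k           ≤⟨ ℕₚ.m≤m+n _ (constant d · k) ⟩
      2 · ℓ + constant d · k + constant d · k ≡⟨ regroup ℓ (constant d · k) ⟩
      2 · (ℓ + constant d · k)         ≤⟨ ℕₚ.*-monoʳ-≤ 2 hi ⟩
      2 · (k C 2)                      ≤⟨ 2·kC2≤k² k ⟩
      k · k                            ∎
      where
      regroup : ∀ a b → 2 · a + b + b ≡ 2 · (a + b)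
      regroup = solve-∀
  many : n · n ^ k ≼ n · (k ! · total) + k · k · n ^ k
  many = subst (λ t → n · n ^ k ≼ n · (k ! · t) + k · k · n ^ k) (sym (length-kSubsets n k)) (many-sized n k)
  rest : suc D · (k · k · n ^ k) ≼ n · (k ! · total)
  rest = ℕₚ.+-cancelʳ-≤ (k · k · n ^ k) _ _ (begin
    suc D · (k · k · n ^ k) + k · k · n ^ k  ≡⟨ regroup D (k · k) (n ^ k) ⟩
    (2 + D) · (k · k) · n ^ k                ≤⟨ ℕₚ.*-monoˡ-≤ (n ^ k) big ⟩
    n · n ^ k                                ≤⟨ many ⟩
    n · (k ! · total) + k · k · n ^ k        ∎)
    where
    regroup : ∀ D a p → suc D · (a · p) + a · p ≡ (2 + D) · a · p
    regroup = solve-∀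

-- The bound on the maximum and on its limit

I≤½+δ : ∀ δ → 0ℚ ℚ.< δ → let c = constant (ℚ.denominator-1 δ) in
  ∀ k ℓ → 1 ≼ k → c · k ≼ ℓ → ℓ + c · k ≼ k C 2 → ∃[ n₀ ] (∀ n → n₀ ≼ n → I n k ℓ ℚ.≤ ½ ℚ.+ δ)
-- The extra `suc` in the witness makes every admissible `n` nonzero.
I≤½+δ δ 0<δ (suc l) ℓ _ lo hi = suc ((2 + ℚ.↧ₙ δ) · (suc l · suc l)) , bound
  where
  bound : ∀ n → suc ((2 + ℚ.↧ₙ δ) · (suc l · suc l)) ≼ n → I n (suc l) ℓ ℚ.≤ ½ ℚ.+ δ
  bound n@(suc _) big with I-attained n (suc l) ℓ
  ... | G , simple , I≡ = subst (ℚ._≤ ½ ℚ.+ δ) (sym I≡)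
    (ℙ≤½+ (kSubsets n (suc l)) (λ A → edgeCount G A ℕ.≟ ℓ) δ 0<δ
      (few-kSubsets (ℚ.denominator-1 δ) l ℓ n lo hi (ℕₚ.<⇒≤ big) G simple))

proposition1p4 : (ε : ℝ) → fromℚ 0ℚ <ℝ ε →
    Σ[ c ∈ ℚ ] Σ[ k₀ ∈ ℕ ] (0ℚ ℚ.< c) × (0 ℕ.< k₀) ×
    ((k ℓ : ℕ) → k₀ ℕ.≤ k →
    c * (+ k / 1) ℚ.≤ + ℓ / 1 →
    + ℓ / 1 ℚ.≤ + (k C 2) / 1 - c * (+ k / 1) →
    (ind : ℝ) → IsEdgeInducibility k ℓ ind →
    ind ≤ℝ fromℚ ½ +ℝ ε)
-- The rational gap δ between 0 and ε fixes `C` through its denominator. `k₀ = 1` is enough: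
-- `C k ≤ ℓ ≤ (k C 2) - C k` already forces `k ≥ 4 C + 1`.
proposition1p4 ε (δ , 0<δ , N , δ≤ε) = fromℕ c , 1 , 0<c , s≤s z≤n , main
  where
  c = constant (ℚ.denominator-1 δ)
  0<c : 0ℚ ℚ.< fromℕ c
  0<c = ℚ.positive⁻¹ (fromℕ c) ⦃ ℚ.normalize-pos c 1 ⦄
  main : (k ℓ : ℕ) → 1 ℕ.≤ k → fromℕ c * fromℕ k ℚ.≤ fromℕ ℓ →
    fromℕ ℓ ℚ.≤ fromℕ (k C 2) - fromℕ c * fromℕ k →
    (ind : ℝ) → IsEdgeInducibility k ℓ ind → ind ≤ℝ fromℚ ½ +ℝ ε
  main k ℓ 1≤k lo hi ind converges η 0<η =
    -- One large `n` suffices. Half of η covers the distance from `I n k ℓ` to the limit, the other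
    -- half the slack in comparing reals through their sequences.
    N ℕ.⊔ N₂ , λ m N≤m → begin
      seq ind m                            ≤⟨ proj₂ close m (ℕₚ.≤-trans (ℕₚ.m≤n⊔m N N₂) N≤m) ⟩
      (I n k ℓ ℚ.+ η/2) ℚ.+ η/2            ≡⟨ ℚ.+-assoc (I n k ℓ) η/2 η/2 ⟩
      I n k ℓ ℚ.+ (η/2 ℚ.+ η/2)            ≡⟨ cong (I n k ℓ ℚ.+_) (trans (sym (ℚ.*-distribʳ-+ η ½ ½)) (ℚ.*-identityˡ η)) ⟩
      I n k ℓ ℚ.+ η                        ≤⟨ ℚ.+-monoˡ-≤ η (ℚ.≤-trans (proj₂ bounded n (ℕₚ.m≤n⊔m N₁ n₀)) (ℚ.+-monoʳ-≤ ½
                                                (subst (ℚ._≤ seq ε m) (ℚ.+-identityˡ δ) (δ≤ε m (ℕₚ.≤-trans (ℕₚ.m≤m⊔n N N₂) N≤m))))) ⟩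
      (½ ℚ.+ seq ε m) ℚ.+ η                ∎
    where
    open ℚ.≤-Reasoning
    η/2 = ½ * η
    0<η/2 : 0ℚ ℚ.< η/2
    0<η/2 = ℚ.*-monoʳ-<-pos ½ 0<η
    lo′ : c · k ≼ ℓ
    lo′ = fromℕ-cancel-≤ (subst (ℚ._≤ fromℕ ℓ) (fromℕ-* c k) lo)
    hi′ : ℓ + c · k ≼ k C 2
    hi′ = fromℕ-cancel-≤ (begin
      fromℕ (ℓ + c · k)                                               ≡⟨ fromℕ-+ ℓ (c · k) ⟨
      fromℕ ℓ ℚ.+ fromℕ (c · k)                                       ≡⟨ cong (fromℕ ℓ ℚ.+_) (fromℕ-* c k) ⟨
      fromℕ ℓ ℚ.+ x                                                   ≤⟨ ℚ.+-monoˡ-≤ x hi ⟩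
      (fromℕ (k C 2) - x) ℚ.+ x                                       ≡⟨ ℚ.+-assoc (fromℕ (k C 2)) (ℚ.- x) x ⟩
      fromℕ (k C 2) ℚ.+ (ℚ.- x ℚ.+ x)                                 ≡⟨ cong (fromℕ (k C 2) ℚ.+_) (ℚ.+-inverseˡ x) ⟩
      fromℕ (k C 2) ℚ.+ 0ℚ                                            ≡⟨ ℚ.+-identityʳ (fromℕ (k C 2)) ⟩
      fromℕ (k C 2)                                                   ∎)
      where x = fromℕ c * fromℕ k
    bounded = I≤½+δ δ 0<δ k ℓ 1≤k lo′ hi′
    n₀ = proj₁ bounded
    N₁ = proj₁ (converges η/2 0<η/2)
    n = N₁ ℕ.⊔ n₀
    close = proj₂ (proj₂ (converges η/2 0<η/2) n (ℕₚ.m≤m⊔n N₁ n₀)) η/2 0<η/2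
    N₂ = proj₁ close
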